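{- Let $n,k,n',k'$ be integers with $k<n<2k-1$, $n/k=n'/k'$, and $k,k'$ both even. Then there is a homomorphism $H_{n,k}\to H_{n',k'}$ if and only if $n'$ and $k'$ are integer multiples of $n$ and $k$, respectively. Moreover, any homomorphism $H_{n,k}\to H_{n',k'}$ is an isomorphism from $H_{n,k}$ to an induced subgraph of $H_{n',k'}$.
   Context: For integers $m\ge j$ with $j$ even, $H_{m,j}$ is the graph whose vertices are the even-weight elements of $\mathbb{Z}_2^m$, with $x\sim y$ iff $x$ and $y$ differ in exactly $j$ coordinates. A homomorphism is an adjacency-preserving map between vertex sets. -}

module Defs where

open import Data.Bool using (Bool; true)
open import Data.Bool.Properties using (_≟_)
open import Data.Irrelevant using ([_])
open import Data.Nat using (ℕ)
open import Data.Nat.Divisibility using (_∣_)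
open import Data.Product using (Σ-syntax; uncurry)
open import Data.Refinement using (Refinement; value; _,_)
open import Data.Vec using (Vec; count; zip)
open import Function.Bundles using (_⇔_)
open import Function.Definitions using (Bijective)
open import Level using (0ℓ)
open import Relation.Binary using (Rel; Symmetric)
open import Relation.Binary.PropositionalEquality using (_≡_; refl; sym; trans; cong)
open import Relation.Nullary using (yes; no; ¬?; contradiction)
open import Relation.Unary using (Pred)

-- Loops are not excluded, so that H m j below is a graph for every j;
-- it has loops only when j = 0.
record Graph : Set₁ where
  field
    Vertex  : Set
    Adj     : Rel Vertex 0ℓ
    Adj-sym : Symmetric Adj

open Graph public

record Hom (G H : Graph) : Set where
  field
    map      : Vertex G → Vertex H
    preserve : ∀ {x y} → Adj G x y → Adj H (map x) (map y)

record IsIsomorphism (G H : Graph) (f : Vertex G → Vertex H) : Set where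
  field
    bijective : Bijective _≡_ _≡_ f
    adjacency : ∀ x y → Adj G x y ⇔ Adj H (f x) (f y)

-- Membership proofs in a refinement are irrelevant, so vertices of the
-- induced subgraph are equal exactly when the underlying vertices are.
induced : (G : Graph) → Pred (Vertex G) 0ℓ → Graph
induced G S = record
  { Vertex  = Refinement (Vertex G) S
  ; Adj     = λ x y → Adj G (value x) (value y)
  ; Adj-sym = Adj-sym G
  }

IsIsomorphismToInducedSubgraph : (G H : Graph) → (Vertex G → Vertex H) → Set₁
IsIsomorphismToInducedSubgraph G H f =
  Σ[ S ∈ Pred (Vertex H) 0ℓ ] Σ[ f∈S ∈ (∀ x → S (f x)) ]
    IsIsomorphism G (induced H S) (λ x → f x , [ f∈S x ])

-- ℤ₂ᵐ is Vec Bool m, with true standing for 1.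
weight : ∀ {m} → Vec Bool m → ℕ
weight = count (_≟ true)

hammingDistance : ∀ {m} → Vec Bool m → Vec Bool m → ℕ
hammingDistance x y = count (uncurry λ a b → ¬? (a ≟ b)) (zip x y)

hammingDistance-sym : ∀ {m} (x y : Vec Bool m) →
                      hammingDistance x y ≡ hammingDistance y x
hammingDistance-sym Vec.[] Vec.[] = refl
hammingDistance-sym (a Vec.∷ x) (b Vec.∷ y) with a ≟ b | b ≟ a
... | yes _   | yes _   = hammingDistance-sym x y
... | no _    | no _    = cong ℕ.suc (hammingDistance-sym x y)
... | yes a≡b | no b≢a  = contradiction (sym a≡b) b≢a
... | no a≢b  | yes b≡a = contradiction (sym b≡a) a≢b

H : ℕ → ℕ → Graph
H m j = record
  { Vertex  = Refinement (Vec Bool m) (λ x → 2 ∣ weight x)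
  ; Adj     = λ x y → hammingDistance (value x) (value y) ≡ j
  ; Adj-sym = λ {x} {y} → trans (hammingDistance-sym (value y) (value x))
  }

{-# OPTIONS --safe #-}
-- Each of the n' coordinates of a homomorphism cuts H n k in two, and every edge
-- is cut by exactly k' of them, so the average cut has density k'/n' = k/n.
-- By the Walsh–Hadamard transform, k/n is an upper bound for all cuts: the least
-- eigenvalue of H n k is the Krawtchouk value at weight 1, and for n < 2k − 1 it
-- is attained only at weights 1 and n − 1.  So every coordinate, as a ±1-valued
-- function, is a combination of the characters (−1)^xᵢ.  Hence, for a fixed x,
-- n' − 2 d(f x, f y) is a combination of the (−1)^(xᵢ + yᵢ); it is constant when
-- d(x, y) = k, which forces equal coefficients and n d(f x, f y) = n' d(x, y).
-- Pairs at distance 2 then give n ∣ n', and f is injective and reflects adjacency.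
-- Conversely, when n' = q n, repeating a vector q times is a homomorphism.
module Submission where

open import Defs
open import Data.Bool using (Bool; true; false; not; _xor_)
import Data.Bool.Properties as 𝔹ₚ
open import Data.Fin using (Fin; zero; suc)
open import Data.Fin.Subset.Properties using (anySubset?)
open import Data.Integer as ℤ using (ℤ; +_; 0ℤ; 1ℤ; +≤+; +<+) renaming (∣_∣ to ∥_∥)
import Data.Integer.Properties as ℤₚ
open import Data.Integer.Tactic.RingSolver using (solve-∀)
open import Data.Irrelevant using ([_])
open import Data.Nat as ℕ using
  (ℕ; zero; suc; z≤n; s≤s; NonZero; ≢-nonZero; ≢-nonZero⁻¹; _≤_; _<_; _+_; _*_; _∸_)
open import Data.Nat.Divisibility using
  (_∣_; divides; divides-refl; quotient; _∣?_; _∣0; ∣-refl; ∣1⇒≡1; ∣n⇒∣m*n; ∣m∣n⇒∣m+n; ∣m+n∣m⇒∣n)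
import Data.Nat.Properties as ℕₚ
import Data.Nat.Tactic.RingSolver as ℕRing
open import Data.Product using (_×_; _,_; proj₁; proj₂; ∃₂; ∃-syntax)
open import Data.Rational using (_/_)
import Data.Rational.Properties as ℚₚ
import Data.Rational.Unnormalised as ℚᵘ
open import Data.Refinement using (Refinement; value; _,_)
open import Data.Sum using (inj₁; inj₂)
open import Data.Vec using (Vec; []; _∷_; _++_; concat; count; lookup; replicate; tail; zipWith)
open import Data.Vec.Properties using (zipWith-++; zipWith-identityʳ; ≡-dec)
open import Function using (_∘_)
open import Function.Bundles using (_⇔_; mk⇔)
open import Level using (0ℓ)
open import Relation.Binary.PropositionalEquality
open import Relation.Nullary using (Dec; contradiction)
open import Relation.Nullary.Decidable using (recompute)

open import Algebra.Properties.CommutativeSemigroup ℕₚ.+-commutativeSemigroup using (x∙yz≈y∙xz)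
open import Algebra.Properties.Semiring.Sum ℤₚ.+-*-semiring using
  (sum; ∑-distrib-+; *-distribˡ-sum; *-distribʳ-sum; sum-cong-≗)

-- The bound on n is what keeps weight 2 out of the extremal eigenspace. Indeed (1 + z)ⁿ⁻¹(1 - z) -
-- (1 + z)ⁿ⁻²(1 - z)² = 2z(1 + z)ⁿ⁻²(1 - z). For n = 2k - 1 the coefficient of zᵏ on the right is
-- twice the middle coefficient of an antipalindromic polynomial, hence 0, and weights 1 and 2 would
-- share an eigenvalue. Krawtchouk values are compared by adding two coordinates at a time. A factor
-- (1 + z)(1 - z) produces two terms, while the extremal value grows by (1 + z)² and gains a central
-- third term, which supplies the room and the strictness. The difficulty lies near 2k = n, where
-- the lower index leaves the range in which the extremal value is positive. Characters of ℤ₂ⁿ with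
-- complementary supports agree on even vectors, which is why weights 1 and n - 1 come together.
-- Dropping one coordinate makes the vertex set the group ℤ₂ᵐ with n = m + 1; weight n - 1 is then
-- the full character of ℤ₂ᵐ and stands for the dropped coordinate.

-- Krawtchouk polynomials

-- K a w k is the coefficient of zᵏ in (1 + z)ᵃ (1 − z)ʷ, that is, the
-- Krawtchouk polynomial K_k of a + w coordinates at w.
shift : (ℕ → ℤ) → ℕ → ℤ
shift f zero    = 0ℤ
shift f (suc k) = f k

K : ℕ → ℕ → ℕ → ℤ
K zero    zero    zero    = 1ℤ
K zero    zero    (suc k) = 0ℤ
K zero    (suc w) k       = K zero w k ℤ.- shift (K zero w) k
K (suc a) w       k       = K a w k ℤ.+ shift (K a w) k

-- `K` peels off the factors 1 + z first; since multiplications by the two factors commute, 1 - z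
-- can be peeled off first as well.
K-sucʳ : ∀ a w k → K a (suc w) k ≡ K a w k ℤ.- shift (K a w) k
K-sucʳ zero    w k       = refl
K-sucʳ (suc a) w zero    rewrite K-sucʳ a w zero = eq (K a w 0)
  where
  eq : ∀ x → x ℤ.- 0ℤ ℤ.+ 0ℤ ≡ x ℤ.+ 0ℤ ℤ.- 0ℤ
  eq = solve-∀
K-sucʳ (suc a) w (suc k) rewrite K-sucʳ a w (suc k) | K-sucʳ a w k =
  eq (K a w (suc k)) (K a w k) (shift (K a w) k)
  where
  eq : ∀ x y z → x ℤ.- y ℤ.+ (y ℤ.- z) ≡ x ℤ.+ y ℤ.- (y ℤ.+ z)
  eq = solve-∀

alt : ℕ → ℤ
alt zero    = 1ℤ
alt (suc k) = ℤ.- alt k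

alt-involutive : ∀ k x → alt k ℤ.* (alt k ℤ.* x) ≡ x
alt-involutive zero    x = trans (ℤₚ.*-identityˡ _) (ℤₚ.*-identityˡ x)
alt-involutive (suc k) x = trans (eq (alt k) x) (alt-involutive k x)
  where
  eq : ∀ s x → ℤ.- s ℤ.* (ℤ.- s ℤ.* x) ≡ s ℤ.* (s ℤ.* x)
  eq = solve-∀

∣alt*∣ : ∀ k x → ∥ alt k ℤ.* x ∥ ≡ ∥ x ∥
∣alt*∣ zero    x = cong ∥_∥ (ℤₚ.*-identityˡ x)
∣alt*∣ (suc k) x = trans (cong ∥_∥ (sym (ℤₚ.neg-distribˡ-* (alt k) x)))
                         (trans (ℤₚ.∣-i∣≡∣i∣ (alt k ℤ.* x)) (∣alt*∣ k x))

-- Replacing z by -z exchanges the two factors and multiplies the coefficient of zᵏ by (-1)ᵏ.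
K-swap : ∀ a w k → K a w k ≡ alt k ℤ.* K w a k
shift-K-swap : ∀ a w k → shift (K a w) k ≡ ℤ.- (alt k ℤ.* shift (K w a) k)

K-swap zero    zero    zero    = refl
K-swap zero    zero    (suc k) = sym (ℤₚ.*-zeroʳ (alt (suc k)))
K-swap zero    (suc w) k
  rewrite K-swap zero w k | shift-K-swap zero w k = eq (alt k) _ _
  where
  eq : ∀ s x y → s ℤ.* x ℤ.- ℤ.- (s ℤ.* y) ≡ s ℤ.* (x ℤ.+ y)
  eq = solve-∀
K-swap (suc a) w       k
  rewrite K-sucʳ w a k | K-swap a w k | shift-K-swap a w k = eq (alt k) _ _
  where
  eq : ∀ s x y → s ℤ.* x ℤ.+ ℤ.- (s ℤ.* y) ≡ s ℤ.* (x ℤ.- y)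
  eq = solve-∀

shift-K-swap a w zero    = refl
shift-K-swap a w (suc k) = trans (K-swap a w k) (eq (alt k) _)
  where
  eq : ∀ s x → s ℤ.* x ≡ ℤ.- (ℤ.- s ℤ.* x)
  eq = solve-∀

∣K-swap∣ : ∀ a w k → ∥ K a w k ∥ ≡ ∥ K w a k ∥
∣K-swap∣ a w k = trans (cong ∥_∥ (K-swap a w k)) (∣alt*∣ k (K w a k))

K-vanishes : ∀ a w {k} → a + w < k → K a w k ≡ 0ℤ
K-vanishes zero    zero    {suc k} _       = refl
K-vanishes zero    (suc w) {suc k} (s≤s p)
  rewrite K-vanishes zero w {suc k} (ℕₚ.m≤n⇒m≤1+n p) | K-vanishes zero w p = refl
K-vanishes (suc a) w       {suc k} (s≤s p)
  rewrite K-vanishes a w {suc k} (ℕₚ.m≤n⇒m≤1+n p) | K-vanishes a w p = refl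

-- Reversing the coefficients fixes 1 + z and negates 1 - z. The recursion meets indices whose sum
-- exceeds the degree by one; `K-reflect-shift` covers them, and its case j = 0 is the index just
-- above the degree.
K-reflect : ∀ a w i j → i + j ≡ a + w → K a w i ≡ alt w ℤ.* K a w j
K-reflect-shift : ∀ a w i j → i + j ≡ suc (a + w) → K a w i ≡ alt w ℤ.* shift (K a w) j

shift-K-reflect : ∀ a w i j → i + j ≡ suc (a + w) → shift (K a w) i ≡ alt w ℤ.* K a w j
shift-K-reflect a w i j eq =
  trans (sym (alt-involutive w _))
        (cong (alt w ℤ.*_) (sym (K-reflect-shift a w j i (trans (ℕₚ.+-comm j i) eq))))

K-reflect zero    zero    zero    zero    _  = refl
K-reflect zero    (suc w) i       j       eq
  rewrite K-reflect-shift zero w i j eq | shift-K-reflect zero w i j eq = ring (alt w) _ _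
  where
  ring : ∀ s x y → s ℤ.* x ℤ.- s ℤ.* y ≡ ℤ.- s ℤ.* (y ℤ.- x)
  ring = solve-∀
K-reflect (suc a) w       i       j       eq
  rewrite K-reflect-shift a w i j eq | shift-K-reflect a w i j eq = ring (alt w) _ _
  where
  ring : ∀ s x y → s ℤ.* x ℤ.+ s ℤ.* y ≡ s ℤ.* (y ℤ.+ x)
  ring = solve-∀

K-reflect-shift a w i zero    eq =
  trans (K-vanishes a w (ℕₚ.≤-reflexive (trans (sym eq) (ℕₚ.+-identityʳ i))))
        (sym (ℤₚ.*-zeroʳ (alt w)))
K-reflect-shift a w i (suc j) eq =
  K-reflect a w i j (ℕₚ.suc-injective (trans (sym (ℕₚ.+-suc i j)) eq))

∣K-reflect∣ : ∀ a w i j → i + j ≡ a + w → ∥ K a w i ∥ ≡ ∥ K a w j ∥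
∣K-reflect∣ a w i j eq = trans (cong ∥_∥ (K-reflect a w i j eq)) (∣alt*∣ w (K a w j))

-- The binomial coefficients are the values of K at w = 0.
K₀-nonNeg : ∀ a k → 0ℤ ℤ.≤ K a 0 k
K₀-nonNeg zero    zero    = +≤+ z≤n
K₀-nonNeg zero    (suc k) = +≤+ z≤n
K₀-nonNeg (suc a) zero    = ℤₚ.+-mono-≤ (K₀-nonNeg a 0) (+≤+ z≤n)
K₀-nonNeg (suc a) (suc k) = ℤₚ.+-mono-≤ (K₀-nonNeg a (suc k)) (K₀-nonNeg a k)

K₀-pos : ∀ a {k} → k ≤ a → 0ℤ ℤ.< K a 0 k
K₀-pos zero    z≤n     = +<+ (s≤s z≤n)
K₀-pos (suc a) z≤n     = ℤₚ.+-mono-<-≤ (K₀-pos a z≤n) (+≤+ z≤n)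
K₀-pos (suc a) (s≤s p) = ℤₚ.+-mono-≤-< (K₀-nonNeg a _) (K₀-pos a p)

-- Coefficient form of (1 + z) B′ = a B for B = (1 + z)ᵃ.
K₀-absorb : ∀ a k → (+ 1 ℤ.+ + k) ℤ.* K a 0 (suc k) ≡ (+ a ℤ.- + k) ℤ.* K a 0 k
K₀-absorb zero    zero    = refl
K₀-absorb zero    (suc k) = trans (ℤₚ.*-zeroʳ (+ 2 ℤ.+ + k)) (sym (ℤₚ.*-zeroʳ (+ 0 ℤ.- + suc k)))
K₀-absorb (suc a) zero    = 
  trans (eq₁ (K a 0 1) (K a 0 0))
        (trans (cong (ℤ._+ K a 0 0) (K₀-absorb a 0)) (eq₂ (+ a) (K a 0 0)))
  where
  eq₁ : ∀ x y → 1ℤ ℤ.* (x ℤ.+ y) ≡ 1ℤ ℤ.* x ℤ.+ y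
  eq₁ = solve-∀
  eq₂ : ∀ a x → (a ℤ.- 0ℤ) ℤ.* x ℤ.+ x ≡ (1ℤ ℤ.+ a ℤ.- 0ℤ) ℤ.* (x ℤ.+ 0ℤ)
  eq₂ = solve-∀
K₀-absorb (suc a) (suc k) = begin
  (1ℤ ℤ.+ (1ℤ ℤ.+ + k)) ℤ.* (K a 0 (2 + k) ℤ.+ y)
    ≡⟨ eq₁ (+ k) (K a 0 (2 + k)) y ⟩
  (1ℤ ℤ.+ + suc k) ℤ.* K a 0 (2 + k) ℤ.+ (1ℤ ℤ.+ (1ℤ ℤ.+ + k)) ℤ.* y
    ≡⟨ cong (ℤ._+ (1ℤ ℤ.+ (1ℤ ℤ.+ + k)) ℤ.* y) (K₀-absorb a (suc k)) ⟩
  (+ a ℤ.- (1ℤ ℤ.+ + k)) ℤ.* y ℤ.+ (1ℤ ℤ.+ (1ℤ ℤ.+ + k)) ℤ.* y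
    ≡⟨ eq₂ (+ a) (+ k) y ⟩
  (+ a ℤ.- + k) ℤ.* y ℤ.+ (1ℤ ℤ.+ + k) ℤ.* y
    ≡⟨ cong (λ z → (+ a ℤ.- + k) ℤ.* y ℤ.+ z) (K₀-absorb a k) ⟩
  (+ a ℤ.- + k) ℤ.* y ℤ.+ (+ a ℤ.- + k) ℤ.* K a 0 k
    ≡⟨ eq₃ (+ a) (+ k) y _ ⟩
  (1ℤ ℤ.+ + a ℤ.- (1ℤ ℤ.+ + k)) ℤ.* (y ℤ.+ K a 0 k) ∎
  where
  open ≡-Reasoning
  y = K a 0 (suc k)
  eq₁ : ∀ k x y → (1ℤ ℤ.+ (1ℤ ℤ.+ k)) ℤ.* (x ℤ.+ y) ≡
        (1ℤ ℤ.+ (1ℤ ℤ.+ k)) ℤ.* x ℤ.+ (1ℤ ℤ.+ (1ℤ ℤ.+ k)) ℤ.* y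
  eq₁ = solve-∀
  eq₂ : ∀ a k y → (a ℤ.- (1ℤ ℤ.+ k)) ℤ.* y ℤ.+ (1ℤ ℤ.+ (1ℤ ℤ.+ k)) ℤ.* y ≡
        (a ℤ.- k) ℤ.* y ℤ.+ (1ℤ ℤ.+ k) ℤ.* y
  eq₂ = solve-∀
  eq₃ : ∀ a k y z → (a ℤ.- k) ℤ.* y ℤ.+ (a ℤ.- k) ℤ.* z ≡
        (1ℤ ℤ.+ a ℤ.- (1ℤ ℤ.+ k)) ℤ.* (y ℤ.+ z)
  eq₃ = solve-∀

-- Minus the least eigenvalue of H (1 + m) k, in the range of the theorem.
D : ℕ → ℕ → ℤ
D m k = ℤ.- K m 1 k

-- A coordinate is 1 in a fraction k/n of the vectors of weight k, so its sign has mean (n - 2k)/n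
-- over them. All sign questions about `D` thus reduce to the sign of 2k - n.
D-K₀ : ∀ m k → + suc m ℤ.* D m k ≡ (+ k ℤ.+ + k ℤ.- + suc m) ℤ.* K (suc m) 0 k
D-K₀ m zero rewrite K-sucʳ m 0 0 = eq (+ m) (K m 0 0)
  where
  eq : ∀ m x → (1ℤ ℤ.+ m) ℤ.* ℤ.- (x ℤ.- 0ℤ) ≡ (0ℤ ℤ.+ 0ℤ ℤ.- (1ℤ ℤ.+ m)) ℤ.* (x ℤ.+ 0ℤ)
  eq = solve-∀
D-K₀ m (suc k) rewrite K-sucʳ m 0 (suc k) = begin
  (1ℤ ℤ.+ + m) ℤ.* ℤ.- (y ℤ.- x)
    ≡⟨ eq₁ (+ m) (+ k) x y ⟩
  (+ 2 ℤ.* (+ m ℤ.- + k)) ℤ.* x ℤ.- + 2 ℤ.* ((1ℤ ℤ.+ + k) ℤ.* y) ℤ.+ c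
    ≡⟨ cong (λ z → (+ 2 ℤ.* (+ m ℤ.- + k)) ℤ.* x ℤ.- + 2 ℤ.* z ℤ.+ c) (K₀-absorb m k) ⟩
  (+ 2 ℤ.* (+ m ℤ.- + k)) ℤ.* x ℤ.- + 2 ℤ.* ((+ m ℤ.- + k) ℤ.* x) ℤ.+ c
    ≡⟨ eq₂ (+ m) (+ k) x c ⟩
  c ∎
  where
  open ≡-Reasoning
  x = K m 0 k
  y = K m 0 (suc k)
  c = (1ℤ ℤ.+ + k ℤ.+ (1ℤ ℤ.+ + k) ℤ.- (1ℤ ℤ.+ + m)) ℤ.* (y ℤ.+ x)
  eq₁ : ∀ m k x y → (1ℤ ℤ.+ m) ℤ.* ℤ.- (y ℤ.- x) ≡
        (+ 2 ℤ.* (m ℤ.- k)) ℤ.* x ℤ.- + 2 ℤ.* ((1ℤ ℤ.+ k) ℤ.* y) ℤ.+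
        (1ℤ ℤ.+ k ℤ.+ (1ℤ ℤ.+ k) ℤ.- (1ℤ ℤ.+ m)) ℤ.* (y ℤ.+ x)
  eq₁ = solve-∀
  eq₂ : ∀ m k x c → (+ 2 ℤ.* (m ℤ.- k)) ℤ.* x ℤ.- + 2 ℤ.* ((m ℤ.- k) ℤ.* x) ℤ.+ c ≡ c
  eq₂ = solve-∀

D-excess : ∀ m k s → k + k ≡ suc m + s → + suc m ℤ.* D m k ≡ + s ℤ.* K (suc m) 0 k
D-excess m k s eq = trans (D-K₀ m k) (cong (ℤ._* K (suc m) 0 k)
  (trans (cong (λ z → + z ℤ.- + suc m) eq) (ring (+ suc m) (+ s))))
  where
  ring : ∀ x y → x ℤ.+ y ℤ.- x ≡ y
  ring = solve-∀

D-nonNeg : ∀ m k s → k + k ≡ suc m + s → 0ℤ ℤ.≤ D m k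
D-nonNeg m k s eq = ℤₚ.*-cancelˡ-≤-pos 0ℤ (D m k) (+ suc m) (begin
  + suc m ℤ.* 0ℤ        ≡⟨ ℤₚ.*-zeroʳ (+ suc m) ⟩
  0ℤ                    ≡⟨ ℤₚ.*-zeroʳ (+ s) ⟨
  + s ℤ.* 0ℤ            ≤⟨ ℤₚ.*-monoˡ-≤-nonNeg (+ s) (K₀-nonNeg (suc m) k) ⟩
  + s ℤ.* K (suc m) 0 k ≡⟨ D-excess m k s eq ⟨
  + suc m ℤ.* D m k     ∎)
  where open ℤₚ.≤-Reasoning

D-pos : ∀ m k s → k + k ≡ suc m + suc s → k ≤ suc m → 0ℤ ℤ.< D m k
D-pos m k s eq k≤ = ℤₚ.*-cancelˡ-<-nonNeg (+ suc m) (begin-strict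
  + suc m ℤ.* 0ℤ            ≡⟨ ℤₚ.*-zeroʳ (+ suc m) ⟩
  0ℤ                        ≡⟨ ℤₚ.*-zeroʳ (+ suc s) ⟨
  + suc s ℤ.* 0ℤ            <⟨ ℤₚ.*-monoˡ-<-pos (+ suc s) (K₀-pos (suc m) k≤) ⟩
  + suc s ℤ.* K (suc m) 0 k ≡⟨ D-excess m k (suc s) eq ⟨
  + suc m ℤ.* D m k         ∎)
  where open ℤₚ.≤-Reasoning

D-antisym : ∀ m i j → i + j ≡ suc m → D m i ≡ ℤ.- D m j
D-antisym m i j eq = cong ℤ.-_ (trans (K-reflect m 1 i j (trans eq (ℕₚ.+-comm 1 m)))
  (trans (sym (ℤₚ.neg-distribˡ-* 1ℤ (K m 1 j))) (cong ℤ.-_ (ℤₚ.*-identityˡ _))))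

-- Both new coordinates lie outside the weight: (1 + z)² = 1 + 2z + z².
D-rec : ∀ m k → D (2 + m) (2 + k) ≡ D m (2 + k) ℤ.+ + 2 ℤ.* D m (1 + k) ℤ.+ D m k
D-rec m k = eq (K m 1 (2 + k)) (K m 1 (1 + k)) (K m 1 k)
  where
  eq : ∀ x y z → ℤ.- (x ℤ.+ y ℤ.+ (y ℤ.+ z)) ≡ ℤ.- x ℤ.+ + 2 ℤ.* ℤ.- y ℤ.+ ℤ.- z
  eq = solve-∀

-- (1 + z)(1 − z) = 1 − z².
K-pair : ∀ a w k → K (suc a) (suc w) (2 + k) ≡ K a w (2 + k) ℤ.- K a w k
K-pair a w k rewrite K-sucʳ a w (2 + k) | K-sucʳ a w (1 + k) =
  eq (K a w (2 + k)) (K a w (1 + k)) (K a w k)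
  where
  eq : ∀ x y z → x ℤ.- y ℤ.+ (y ℤ.- z) ≡ x ℤ.- z
  eq = solve-∀

∣K-pair∣ : ∀ a w k → + ∥ K (suc a) (suc w) (2 + k) ∥ ℤ.≤ + ∥ K a w (2 + k) ∥ ℤ.+ + ∥ K a w k ∥
∣K-pair∣ a w k rewrite K-pair a w k = +≤+ (ℤₚ.∣i-j∣≤∣i∣+∣j∣ (K a w (2 + k)) (K a w k))

double-suc : ∀ n k {s} → k + k ≡ n + s → suc k + suc k ≡ n + (2 + s)
double-suc n k {s} eq = trans (cong suc (ℕₚ.+-suc k k))
  (trans (cong (λ x → 2 + x) eq) (x∙yz≈y∙xz 2 n s))

double-suc⁻¹ : ∀ n k {s} → suc k + suc k ≡ n + (2 + s) → k + k ≡ n + s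
double-suc⁻¹ n k {s} eq = ℕₚ.+-cancelˡ-≡ 2 (k + k) (n + s)
  (trans (trans (sym (cong suc (ℕₚ.+-suc k k))) eq) (x∙yz≈y∙xz n 2 s))

≡⇒≡+0 : ∀ {k n} → k ≡ n → k ≡ n + 0
≡⇒≡+0 eq = trans eq (sym (ℕₚ.+-identityʳ _))

-- Comparison of Krawtchouk values with the one at weight 1

module _ where

  open ℤₚ.≤-Reasoning

  ∣K∣≤D-edge : ∀ m k s → k + k ≡ suc m + s → + ∥ K m 1 k ∥ ℤ.≤ D m k
  ∣K∣≤D-edge m k s eq = ℤₚ.≤-reflexive (trans
    (cong +_ (sym (ℤₚ.∣-i∣≡∣i∣ (K m 1 k)))) (ℤₚ.0≤i⇒+∣i∣≡i (D-nonNeg m k s eq)))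

  D-middle-suc-pos : ∀ m k → k + k ≡ suc m → 0ℤ ℤ.< D m (1 + k)
  D-middle-suc-pos m k eq = D-pos m (1 + k) 1 (double-suc (suc m) k (≡⇒≡+0 eq)) (k< k eq)
    where
    k< : ∀ k → k + k ≡ suc m → 1 + k ≤ suc m
    k< (suc j) e = subst (suc (suc j) ≤_) e (s≤s (ℕₚ.m≤n+m (suc j) j))

  ∣K∣-middle-edge : ∀ m k → k + k ≡ suc m → + ∥ K m 1 k ∥ ℤ.< + 2 ℤ.* D m (1 + k)
  ∣K∣-middle-edge m k eq = begin-strict
    + ∥ K m 1 k ∥         ≤⟨ ∣K∣≤D-edge m k 0 (≡⇒≡+0 eq) ⟩
    D m k                 ≡⟨ zero-D ⟩
    + 2 ℤ.* 0ℤ            <⟨ ℤₚ.*-monoˡ-<-pos (+ 2) (D-middle-suc-pos m k eq) ⟩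
    + 2 ℤ.* D m (1 + k)   ∎
    where
    zero-D : D m k ≡ 0ℤ
    zero-D = ℤₚ.*-cancelˡ-≡ (+ suc m) (D m k) 0ℤ
      (trans (D-excess m k 0 (≡⇒≡+0 eq)) (sym (ℤₚ.*-zeroʳ (+ suc m))))

  -- |K_k(w)| ≤ |K_k(1)| for 0 < w < n and 2k > n, on n = a + w + 2 coordinates.
  -- For 2k = n the right-hand side vanishes; ∣K∣-middle is the
  -- substitute that makes the induction step to 2k = n + 2 work.
  ∣K∣≤D : ∀ a w k s → k + k ≡ suc (suc (a + w)) + suc s →
          + ∥ K (suc a) (suc w) k ∥ ℤ.≤ D (suc (a + w)) k
  ∣K∣-middle : ∀ a w k → k + k ≡ suc (suc (a + w)) →
               + ∥ K (suc a) (suc w) k ∥ ℤ.< + 2 ℤ.* D (suc (a + w)) (1 + k)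

  -- Here `D m k` is 0 and cannot absorb the term of index k, which is charged to the central term
  -- `+ 2 ℤ.* D m (1 + k)` of `D-rec` instead.
  ∣K-pair∣<D-middle : ∀ a w k → k + k ≡ suc (suc (a + w)) →
                      + ∥ K (2 + a) (2 + w) (2 + k) ∥ ℤ.< D (3 + (a + w)) (2 + k)
  ∣K-pair∣<D-middle a w k eq = begin-strict
    + ∥ K (2 + a) (2 + w) (2 + k) ∥
      ≤⟨ ∣K-pair∣ (suc a) (suc w) k ⟩
    + ∥ K (1 + a) (1 + w) (2 + k) ∥ ℤ.+ + ∥ K (1 + a) (1 + w) k ∥
      <⟨ ℤₚ.+-mono-≤-< (∣K∣≤D a w (2 + k) 3 (double-suc (suc m) (suc k) (double-suc (suc m) k eq₀)))
                       (∣K∣-middle a w k eq) ⟩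
    D m (2 + k) ℤ.+ + 2 ℤ.* D m (1 + k)
      ≡⟨ ℤₚ.+-identityʳ (D m (2 + k) ℤ.+ + 2 ℤ.* D m (1 + k)) ⟨
    D m (2 + k) ℤ.+ + 2 ℤ.* D m (1 + k) ℤ.+ 0ℤ
      ≤⟨ ℤₚ.+-monoʳ-≤ (D m (2 + k) ℤ.+ + 2 ℤ.* D m (1 + k)) (D-nonNeg m k 0 eq₀) ⟩
    D m (2 + k) ℤ.+ + 2 ℤ.* D m (1 + k) ℤ.+ D m k
      ≡⟨ D-rec m k ⟨
    D (2 + m) (2 + k) ∎
    where
    m = suc (a + w)
    eq₀ : k + k ≡ suc m + 0
    eq₀ = ≡⇒≡+0 eq

  -- The summand `+ 2 ℤ.* 0ℤ` holds the place of the central term of `D-rec`: it remains to compare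
  -- that term with 0, weakly for the bound and strictly for uniqueness.
  ∣K-pair∣≤D+D : ∀ a w k s → k + k ≡ suc (suc (a + w)) + suc s →
                 + ∥ K (2 + a) (2 + w) (2 + k) ∥ ℤ.≤
                 D (suc (a + w)) (2 + k) ℤ.+ + 2 ℤ.* 0ℤ ℤ.+ D (suc (a + w)) k
  ∣K-pair∣≤D+D a w k s eq = begin
    + ∥ K (2 + a) (2 + w) (2 + k) ∥
      ≤⟨ ∣K-pair∣ (suc a) (suc w) k ⟩
    + ∥ K (1 + a) (1 + w) (2 + k) ∥ ℤ.+ + ∥ K (1 + a) (1 + w) k ∥
      ≤⟨ ℤₚ.+-mono-≤ (∣K∣≤D a w (2 + k) (4 + s) (double-suc (suc m) (suc k) (double-suc (suc m) k eq)))
                     (∣K∣≤D a w k s eq) ⟩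
    D m (2 + k) ℤ.+ D m k
      ≡⟨ cong (ℤ._+ D m k) (ℤₚ.+-identityʳ (D m (2 + k))) ⟨
    D m (2 + k) ℤ.+ + 2 ℤ.* 0ℤ ℤ.+ D m k ∎
    where m = suc (a + w)

  -- Above the middle, strictness is the positivity of the central term `D m (1 + k)`, which needs 1
  -- + k to be at most the number `suc m` of coordinates. This is where k < n enters.
  ∣K-pair∣<D : ∀ a w k s → k + k ≡ suc (suc (a + w)) + s → k ≤ suc (a + w) →
               + ∥ K (2 + a) (2 + w) (2 + k) ∥ ℤ.< D (3 + (a + w)) (2 + k)
  ∣K-pair∣<D a w k zero    eq _  = ∣K-pair∣<D-middle a w k (trans eq (ℕₚ.+-identityʳ _))
  ∣K-pair∣<D a w k (suc s) eq k≤ = begin-strict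
    + ∥ K (2 + a) (2 + w) (2 + k) ∥
      ≤⟨ ∣K-pair∣≤D+D a w k s eq ⟩
    D m (2 + k) ℤ.+ + 2 ℤ.* 0ℤ ℤ.+ D m k
      <⟨ ℤₚ.+-monoˡ-< (D m k) (ℤₚ.+-monoʳ-< (D m (2 + k)) (ℤₚ.*-monoˡ-<-pos (+ 2)
           (D-pos m (1 + k) (2 + s) (double-suc (suc m) k eq) (s≤s k≤)))) ⟩
    D m (2 + k) ℤ.+ + 2 ℤ.* D m (1 + k) ℤ.+ D m k
      ≡⟨ D-rec m k ⟨
    D (2 + m) (2 + k) ∎
    where m = suc (a + w)

  ∣K-pair∣≤D : ∀ a w k s → 2 + k + (2 + k) ≡ suc (suc (a + w)) + (3 + s) →
               + ∥ K (2 + a) (2 + w) (2 + k) ∥ ℤ.≤ D (3 + (a + w)) (2 + k)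
  -- With n = a + w + 2, here 2k = n - 1: the lower index is below the middle and the induction
  -- hypothesis does not apply to it. Reflection moves it to 1 + k, and on the right `D m k` = -
  -- `D m (1 + k)` cancels one of the two central copies, so both sides match.
  ∣K-pair∣≤D a w k zero eq = begin
    + ∥ K (2 + a) (2 + w) (2 + k) ∥
      ≤⟨ ∣K-pair∣ (suc a) (suc w) k ⟩
    + ∥ K (1 + a) (1 + w) (2 + k) ∥ ℤ.+ + ∥ K (1 + a) (1 + w) k ∥
      ≡⟨ cong (λ x → + ∥ K (1 + a) (1 + w) (2 + k) ∥ ℤ.+ + x)
              (∣K-reflect∣ (1 + a) (1 + w) k (1 + k)
                 (trans reflect (cong suc (sym (ℕₚ.+-suc a w))))) ⟩
    + ∥ K (1 + a) (1 + w) (2 + k) ∥ ℤ.+ + ∥ K (1 + a) (1 + w) (1 + k) ∥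
      ≤⟨ ℤₚ.+-mono-≤ (∣K∣≤D a w (2 + k) 2 eq) (∣K∣≤D a w (1 + k) 0 eq₁) ⟩
    D m (2 + k) ℤ.+ D m (1 + k)
      ≡⟨ ring (D m (2 + k)) (D m (1 + k)) ⟩
    D m (2 + k) ℤ.+ + 2 ℤ.* D m (1 + k) ℤ.+ ℤ.- D m (1 + k)
      ≡⟨ cong (λ x → D m (2 + k) ℤ.+ + 2 ℤ.* D m (1 + k) ℤ.+ x)
              (D-antisym m k (1 + k) reflect) ⟨
    D m (2 + k) ℤ.+ + 2 ℤ.* D m (1 + k) ℤ.+ D m k
      ≡⟨ D-rec m k ⟨
    D (2 + m) (2 + k) ∎
    where
    m = suc (a + w)
    eq₁ : suc k + suc k ≡ suc m + 1
    eq₁ = double-suc⁻¹ (suc m) (suc k) eq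
    reflect : k + suc k ≡ suc m
    reflect = ℕₚ.suc-injective (trans eq₁ (ℕₚ.+-comm (suc m) 1))
    ring : ∀ x y → x ℤ.+ y ≡ x ℤ.+ + 2 ℤ.* y ℤ.+ ℤ.- y
    ring = solve-∀
  ∣K-pair∣≤D a w k (suc zero) eq = ℤₚ.<⇒≤ (∣K-pair∣<D-middle a w k
    (trans (double-suc⁻¹ n k (double-suc⁻¹ n (suc k) eq)) (ℕₚ.+-identityʳ n)))
    where n = suc (suc (a + w))
  ∣K-pair∣≤D a w k (suc (suc s)) eq = begin
    + ∥ K (2 + a) (2 + w) (2 + k) ∥
      ≤⟨ ∣K-pair∣≤D+D a w k s eq₀ ⟩
    D m (2 + k) ℤ.+ + 2 ℤ.* 0ℤ ℤ.+ D m k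
      ≤⟨ ℤₚ.+-monoˡ-≤ (D m k) (ℤₚ.+-monoʳ-≤ (D m (2 + k)) (ℤₚ.*-monoˡ-≤-nonNeg (+ 2)
           (D-nonNeg m (1 + k) (3 + s) (double-suc (suc m) k eq₀)))) ⟩
    D m (2 + k) ℤ.+ + 2 ℤ.* D m (1 + k) ℤ.+ D m k
      ≡⟨ D-rec m k ⟨
    D (2 + m) (2 + k) ∎
    where
    m = suc (a + w)
    eq₀ : k + k ≡ suc m + suc s
    eq₀ = double-suc⁻¹ (suc m) k (double-suc⁻¹ (suc m) (suc k) eq)

  ∣K∣≤D a zero k s eq rewrite ℕₚ.+-identityʳ a = ∣K∣≤D-edge (suc a) k (suc s) eq
  ∣K∣≤D zero (suc w) k s eq rewrite ∣K-swap∣ 1 (2 + w) k = ∣K∣≤D-edge (2 + w) k (suc s) eq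
  ∣K∣≤D (suc a) (suc w) (suc zero) s ()
  ∣K∣≤D (suc a) (suc w) (suc (suc k)) s eq rewrite ℕₚ.+-suc a w =
    ∣K-pair∣≤D a w k s (trans eq (x∙yz≈y∙xz 2 (2 + (a + w)) (suc s)))

  ∣K∣-middle a zero k eq rewrite ℕₚ.+-identityʳ a = ∣K∣-middle-edge (suc a) k eq
  ∣K∣-middle zero (suc w) k eq rewrite ∣K-swap∣ 1 (2 + w) k = ∣K∣-middle-edge (2 + w) k eq
  ∣K∣-middle (suc a) (suc w) (suc zero) ()
  -- The indices k and 2 + k are mirror images about the middle of the smaller cube, so both terms
  -- obey the bound at 2 + k. The target contains four copies of that bound, hence the strict
  -- inequality.
  ∣K∣-middle (suc a) (suc w) (suc (suc k)) eq rewrite ℕₚ.+-suc a w = begin-strict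
    + ∥ K (2 + a) (2 + w) (2 + k) ∥
      ≤⟨ ∣K-pair∣ (suc a) (suc w) k ⟩
    + ∥ K (1 + a) (1 + w) (2 + k) ∥ ℤ.+ + ∥ K (1 + a) (1 + w) k ∥
      ≡⟨ cong (λ x → + ∥ K (1 + a) (1 + w) (2 + k) ∥ ℤ.+ + x)
              (∣K-reflect∣ (1 + a) (1 + w) k (2 + k) reflect) ⟩
    + ∥ K (1 + a) (1 + w) (2 + k) ∥ ℤ.+ + ∥ K (1 + a) (1 + w) (2 + k) ∥
      ≤⟨ ℤₚ.+-mono-≤ bound bound ⟩
    D m (2 + k) ℤ.+ D m (2 + k)
      ≡⟨ ring (D m (2 + k)) ⟩
    + 2 ℤ.* (0ℤ ℤ.+ D m (2 + k) ℤ.+ 0ℤ)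
      <⟨ ℤₚ.*-monoˡ-<-pos (+ 2) (ℤₚ.+-mono-<-≤ (ℤₚ.+-mono-≤-< D₊≥0 D₀<2D₀) D₋≥0) ⟩
    + 2 ℤ.* (D m (3 + k) ℤ.+ + 2 ℤ.* D m (2 + k) ℤ.+ D m (1 + k))
      ≡⟨ cong (+ 2 ℤ.*_) (D-rec m (1 + k)) ⟨
    + 2 ℤ.* D (2 + m) (3 + k) ∎
    where
    m = suc (a + w)
    eq₁ : suc k + suc k ≡ suc m
    eq₁ = ℕₚ.suc-injective (ℕₚ.suc-injective (trans (cong suc (sym (ℕₚ.+-suc (suc k) (suc k)))) eq))
    reflect : k + (2 + k) ≡ 1 + a + (1 + w)
    reflect = trans (ℕₚ.+-suc k (suc k)) (trans eq₁ (cong suc (sym (ℕₚ.+-suc a w))))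
    eq₂ : 2 + k + (2 + k) ≡ suc m + 2
    eq₂ = double-suc (suc m) (suc k) (≡⇒≡+0 eq₁)
    bound : + ∥ K (1 + a) (1 + w) (2 + k) ∥ ℤ.≤ D m (2 + k)
    bound = ∣K∣≤D a w (2 + k) 1 eq₂
    D₊≥0 : 0ℤ ℤ.≤ D m (3 + k)
    D₊≥0 = D-nonNeg m (3 + k) 4 (double-suc (suc m) (2 + k) eq₂)
    D₋≥0 : 0ℤ ℤ.≤ D m (1 + k)
    D₋≥0 = D-nonNeg m (1 + k) 0 (≡⇒≡+0 eq₁)
    D₀<2D₀ : D m (2 + k) ℤ.< + 2 ℤ.* D m (2 + k)
    D₀<2D₀ = begin-strict
      D m (2 + k)                   ≡⟨ ℤₚ.+-identityʳ (D m (2 + k)) ⟨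
      D m (2 + k) ℤ.+ 0ℤ            <⟨ ℤₚ.+-monoʳ-< (D m (2 + k)) (D-middle-suc-pos m (suc k) eq₁) ⟩
      D m (2 + k) ℤ.+ D m (2 + k)   ≡⟨ ring′ (D m (2 + k)) ⟩
      + 2 ℤ.* D m (2 + k)           ∎
      where
      ring′ : ∀ x → x ℤ.+ x ≡ + 2 ℤ.* x
      ring′ = solve-∀
    ring : ∀ x → x ℤ.+ x ≡ + 2 ℤ.* (0ℤ ℤ.+ x ℤ.+ 0ℤ)
    ring = solve-∀

negated-bound-≤ : ∀ x {y} → + ∥ x ∥ ℤ.≤ y → 0ℤ ℤ.≤ x ℤ.+ y
negated-bound-≤ x p = ℤₚ.≤-trans (0≤x+∣x∣ x) (ℤₚ.+-monoʳ-≤ x p)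
  where
  0≤x+∣x∣ : ∀ x → 0ℤ ℤ.≤ x ℤ.+ + ∥ x ∥
  0≤x+∣x∣ (+ n)      = +≤+ z≤n
  0≤x+∣x∣ (ℤ.-[1+ n ]) = ℤₚ.≤-reflexive (sym (ℤₚ.+-inverseˡ (+ suc n)))

negated-bound-< : ∀ x {y} → + ∥ x ∥ ℤ.< y → 0ℤ ℤ.< x ℤ.+ y
negated-bound-< x p = ℤₚ.≤-<-trans (negated-bound-≤ x ℤₚ.≤-refl) (ℤₚ.+-monoʳ-< x p)

-- Weight 0 is outside the range of `∣K∣≤D`; there `K` is a binomial coefficient and already
-- nonnegative.
K+D-nonNeg : ∀ a w k s → k + k ≡ suc (a + w) + suc s → 0ℤ ℤ.≤ K (suc a) w k ℤ.+ D (a + w) k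
K+D-nonNeg a zero    k s eq = ℤₚ.+-mono-≤ (K₀-nonNeg (suc a) k) (D-nonNeg (a + 0) k (suc s) eq)
K+D-nonNeg a (suc w) k s eq rewrite ℕₚ.+-suc a w =
  negated-bound-≤ (K (suc a) (suc w) k) (∣K∣≤D a w k s eq)

-- On n = suc (a + w) coordinates, a = 0 is weight n - 1. The excess 2 + s of 2k over n, rather than
-- 1 + s, is the use of n < 2k - 1.
K+D-pos : ∀ a w k s → k + k ≡ suc (a + w) + (2 + s) → k ≤ a + w → a ≢ 0 → w ≢ 1 →
          0ℤ ℤ.< K (suc a) w k ℤ.+ D (a + w) k
K+D-pos zero    _             _             _ _  _  a≢0 _ = contradiction refl a≢0
K+D-pos _       (suc zero)    _             _ _  _  _ w≢1 = contradiction refl w≢1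
K+D-pos a       zero          k             s eq k≤ _ _ = ℤₚ.+-mono-<-≤
  (K₀-pos (suc a) (ℕₚ.m≤n⇒m≤1+n (subst (k ≤_) (ℕₚ.+-identityʳ a) k≤)))
  (D-nonNeg (a + 0) k (2 + s) eq)
K+D-pos (suc a) (suc (suc w)) (suc zero)    s eq k≤ _ _
  rewrite ℕₚ.+-suc a (suc w) with () ← eq
K+D-pos (suc a) (suc (suc w)) (suc (suc k)) s eq k≤ _ _
  rewrite ℕₚ.+-suc a (suc w) | ℕₚ.+-suc a w =
  negated-bound-< (K (2 + a) (2 + w) (2 + k)) (∣K-pair∣<D a w k s
    (double-suc⁻¹ (2 + (a + w)) k (double-suc⁻¹ (2 + (a + w)) (suc k) eq′))
    (ℕₚ.≤-pred (ℕₚ.≤-pred k≤)))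
  where
  eq′ : 2 + k + (2 + k) ≡ 2 + (a + w) + (2 + (2 + s))
  eq′ = trans eq (x∙yz≈y∙xz 2 (2 + (a + w)) (2 + s))

-- Fourier analysis on the cube

Cube : ℕ → Set
Cube = Vec Bool

infixl 6 _⊕_
_⊕_ : ∀ {m} → Cube m → Cube m → Cube m
_⊕_ = zipWith _xor_

sign : Bool → ℤ
sign false = 1ℤ
sign true  = ℤ.- 1ℤ

total : ∀ {m} → (Cube m → ℤ) → ℤ
total {zero}  f = f []
total {suc m} f = total (f ∘ (false ∷_)) ℤ.+ total (f ∘ (true ∷_))

total-cong : ∀ {m} {f g : Cube m → ℤ} → (∀ x → f x ≡ g x) → total f ≡ total g
total-cong {zero}  f≗g = f≗g []
total-cong {suc m} f≗g = cong₂ ℤ._+_ (total-cong (f≗g ∘ (false ∷_))) (total-cong (f≗g ∘ (true ∷_)))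

total-+ : ∀ {m} (f g : Cube m → ℤ) → total (λ x → f x ℤ.+ g x) ≡ total f ℤ.+ total g
total-+ {zero}  f g = refl
total-+ {suc m} f g
  rewrite total-+ (f ∘ (false ∷_)) (g ∘ (false ∷_)) | total-+ (f ∘ (true ∷_)) (g ∘ (true ∷_)) =
  eq (total (f ∘ (false ∷_))) (total (g ∘ (false ∷_))) (total (f ∘ (true ∷_))) (total (g ∘ (true ∷_)))
  where
  eq : ∀ a b c d → a ℤ.+ b ℤ.+ (c ℤ.+ d) ≡ a ℤ.+ c ℤ.+ (b ℤ.+ d)
  eq = solve-∀

total-* : ∀ {m} c (f : Cube m → ℤ) → total (λ x → c ℤ.* f x) ≡ c ℤ.* total f
total-* {zero}  c f = refl
total-* {suc m} c f rewrite total-* c (f ∘ (false ∷_)) | total-* c (f ∘ (true ∷_)) =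
  sym (ℤₚ.*-distribˡ-+ c (total (f ∘ (false ∷_))) (total (f ∘ (true ∷_))))

total-nonNeg : ∀ {m} {f : Cube m → ℤ} → (∀ x → 0ℤ ℤ.≤ f x) → 0ℤ ℤ.≤ total f
total-nonNeg {zero}  f≥0 = f≥0 []
total-nonNeg {suc m} f≥0 = ℤₚ.+-mono-≤ (total-nonNeg (f≥0 ∘ (false ∷_))) (total-nonNeg (f≥0 ∘ (true ∷_)))

nonNeg-+-zero : ∀ {x y} → 0ℤ ℤ.≤ x → 0ℤ ℤ.≤ y → x ℤ.+ y ≡ 0ℤ → x ≡ 0ℤ × y ≡ 0ℤ
nonNeg-+-zero {+ zero}  {+ zero} _ _ _ = refl , refl
nonNeg-+-zero {+ suc _} {+ _}    _ _ ()
nonNeg-+-zero {+ zero}  {+ suc _}    _ _ ()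

total-zero⁻¹ : ∀ {m} {f : Cube m → ℤ} → (∀ x → 0ℤ ℤ.≤ f x) → total f ≡ 0ℤ → ∀ x → f x ≡ 0ℤ
total-zero⁻¹ f≥0 eq []      = eq
total-zero⁻¹ f≥0 eq (b ∷ x)
  with b | nonNeg-+-zero (total-nonNeg (f≥0 ∘ (false ∷_))) (total-nonNeg (f≥0 ∘ (true ∷_))) eq
... | false | eq₀ , _ = total-zero⁻¹ (f≥0 ∘ (false ∷_)) eq₀ x
... | true  | _ , eq₁ = total-zero⁻¹ (f≥0 ∘ (true ∷_)) eq₁ x

sum-nonNeg : ∀ {n} {t : Fin n → ℤ} → (∀ j → 0ℤ ℤ.≤ t j) → 0ℤ ℤ.≤ sum t
sum-nonNeg {zero}  t≥0 = +≤+ z≤n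
sum-nonNeg {suc n} t≥0 = ℤₚ.+-mono-≤ (t≥0 zero) (sum-nonNeg (t≥0 ∘ suc))

sum-zero⁻¹ : ∀ {n} {t : Fin n → ℤ} → (∀ j → 0ℤ ℤ.≤ t j) → sum t ≡ 0ℤ → ∀ j → t j ≡ 0ℤ
sum-zero⁻¹ {suc n} t≥0 eq zero    = proj₁ (nonNeg-+-zero (t≥0 zero) (sum-nonNeg (t≥0 ∘ suc)) eq)
sum-zero⁻¹ {suc n} t≥0 eq (suc j) =
  sum-zero⁻¹ (t≥0 ∘ suc) (proj₂ (nonNeg-+-zero (t≥0 zero) (sum-nonNeg (t≥0 ∘ suc)) eq)) j

sum-total : ∀ {m n} (f : Fin n → Cube m → ℤ) → sum (λ j → total (f j)) ≡ total (λ x → sum (λ j → f j x))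
sum-total {zero}  f = refl
sum-total {suc m} f = trans
  (∑-distrib-+ (λ j → total (f j ∘ (false ∷_))) (λ j → total (f j ∘ (true ∷_))))
  (cong₂ ℤ._+_ (sum-total (λ j → f j ∘ (false ∷_))) (sum-total (λ j → f j ∘ (true ∷_))))

total-shift : ∀ {m} (f : Cube m → ℤ) x → total (λ y → f (x ⊕ y)) ≡ total f
total-shift f []          = refl
total-shift f (false ∷ x) =
  cong₂ ℤ._+_ (total-shift (f ∘ (false ∷_)) x) (total-shift (f ∘ (true ∷_)) x)
total-shift f (true ∷ x)  = trans
  (cong₂ ℤ._+_ (total-shift (f ∘ (true ∷_)) x) (total-shift (f ∘ (false ∷_)) x))
  (ℤₚ.+-comm (total (f ∘ (true ∷_))) (total (f ∘ (false ∷_))))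

-- The Walsh–Hadamard transform.
hat : ∀ {m} → (Cube m → ℤ) → Cube m → ℤ
hat f []      = f []
hat f (b ∷ W) = hat (f ∘ (false ∷_)) W ℤ.+ sign b ℤ.* hat (f ∘ (true ∷_)) W

hat-cong : ∀ {m} {f g : Cube m → ℤ} → (∀ x → f x ≡ g x) → ∀ W → hat f W ≡ hat g W
hat-cong f≗g []      = f≗g []
hat-cong f≗g (b ∷ W) =
  cong₂ (λ x y → x ℤ.+ sign b ℤ.* y) (hat-cong (f≗g ∘ (false ∷_)) W) (hat-cong (f≗g ∘ (true ∷_)) W)

hat-+* : ∀ {m} c (f g : Cube m → ℤ) W → hat (λ x → f x ℤ.+ c ℤ.* g x) W ≡ hat f W ℤ.+ c ℤ.* hat g W
hat-+* c f g []      = refl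
hat-+* c f g (b ∷ W)
  rewrite hat-+* c (f ∘ (false ∷_)) (g ∘ (false ∷_)) W | hat-+* c (f ∘ (true ∷_)) (g ∘ (true ∷_)) W =
  eq c (sign b) (hat (f ∘ (false ∷_)) W) (hat (f ∘ (true ∷_)) W)
     (hat (g ∘ (false ∷_)) W) (hat (g ∘ (true ∷_)) W)
  where
  eq : ∀ c s f₀ f₁ g₀ g₁ → f₀ ℤ.+ c ℤ.* g₀ ℤ.+ s ℤ.* (f₁ ℤ.+ c ℤ.* g₁) ≡
       f₀ ℤ.+ s ℤ.* f₁ ℤ.+ c ℤ.* (g₀ ℤ.+ s ℤ.* g₁)
  eq = solve-∀

hat-zero : ∀ {m} (W : Cube m) → hat (λ _ → 0ℤ) W ≡ 0ℤ
hat-zero []      = refl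
hat-zero (b ∷ W) rewrite hat-zero W = trans (ℤₚ.+-identityˡ _) (ℤₚ.*-zeroʳ (sign b))

hat-vanishes : ∀ {m} {f : Cube m → ℤ} → (∀ x → f x ≡ 0ℤ) → ∀ W → hat f W ≡ 0ℤ
hat-vanishes f≗0 W = trans (hat-cong f≗0 W) (hat-zero W)

hat-sum : ∀ {m n} (c : Fin n → ℤ) (g : Fin n → Cube m → ℤ) W →
          hat (λ x → sum (λ j → c j ℤ.* g j x)) W ≡ sum (λ j → c j ℤ.* hat (g j) W)
hat-sum {n = zero}  c g W = hat-zero W
hat-sum {n = suc n} c g W = begin
  hat (λ x → c zero ℤ.* g zero x ℤ.+ rest x) W
    ≡⟨ hat-cong (λ x → ℤₚ.+-comm (c zero ℤ.* g zero x) (rest x)) W ⟩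
  hat (λ x → rest x ℤ.+ c zero ℤ.* g zero x) W
    ≡⟨ hat-+* (c zero) rest (g zero) W ⟩
  hat rest W ℤ.+ c zero ℤ.* hat (g zero) W
    ≡⟨ ℤₚ.+-comm (hat rest W) _ ⟩
  c zero ℤ.* hat (g zero) W ℤ.+ hat rest W
    ≡⟨ cong (λ z → c zero ℤ.* hat (g zero) W ℤ.+ z) (hat-sum (c ∘ suc) (g ∘ suc) W) ⟩
  sum (λ j → c j ℤ.* hat (g j) W) ∎
  where
  open ≡-Reasoning
  rest = λ x → sum (λ j → c (suc j) ℤ.* g (suc j) x)

-- Fourier inversion with the factor 2ᵐ left undivided, so that everything stays in ℤ.
hat-hat : ∀ {m} (f : Cube m → ℤ) x → hat (hat f) x ≡ (+ 2) ℤ.^ m ℤ.* f x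
hat-hat         f []      = sym (ℤₚ.*-identityˡ (f []))
hat-hat {suc m} f (b ∷ x)
  rewrite hat-+* 1ℤ (hat (f ∘ (false ∷_))) (hat (f ∘ (true ∷_))) x
        | hat-+* (ℤ.- 1ℤ) (hat (f ∘ (false ∷_))) (hat (f ∘ (true ∷_))) x
        | hat-hat (f ∘ (false ∷_)) x | hat-hat (f ∘ (true ∷_)) x = by-cases b
  where
  eq₀ : ∀ N x y → N ℤ.* x ℤ.+ 1ℤ ℤ.* (N ℤ.* y) ℤ.+ 1ℤ ℤ.* (N ℤ.* x ℤ.+ ℤ.- 1ℤ ℤ.* (N ℤ.* y)) ≡
        + 2 ℤ.* N ℤ.* x
  eq₀ = solve-∀
  eq₁ : ∀ N x y → N ℤ.* x ℤ.+ 1ℤ ℤ.* (N ℤ.* y) ℤ.+ ℤ.- 1ℤ ℤ.* (N ℤ.* x ℤ.+ ℤ.- 1ℤ ℤ.* (N ℤ.* y)) ≡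
        + 2 ℤ.* N ℤ.* y
  eq₁ = solve-∀
  N  = (+ 2) ℤ.^ m
  f₀ = f (false ∷ x)
  f₁ = f (true ∷ x)
  by-cases : ∀ b → N ℤ.* f₀ ℤ.+ 1ℤ ℤ.* (N ℤ.* f₁) ℤ.+ sign b ℤ.* (N ℤ.* f₀ ℤ.+ ℤ.- 1ℤ ℤ.* (N ℤ.* f₁)) ≡
             + 2 ℤ.* N ℤ.* f (b ∷ x)
  by-cases false = eq₀ N f₀ f₁
  by-cases true  = eq₁ N f₀ f₁

total-hat : ∀ {m} (f : Cube m → ℤ) → total f ≡ hat f (replicate m false)
total-hat {zero}  f = refl
total-hat {suc m} f = cong₂ ℤ._+_ (total-hat (f ∘ (false ∷_)))
  (trans (total-hat (f ∘ (true ∷_))) (sym (ℤₚ.*-identityˡ _)))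

spectral : ∀ {m} (f g h : Cube m → ℤ) → ℤ
spectral f g h = total (λ W → hat f W ℤ.* hat g W ℤ.* hat h W)

convolution : ∀ {m} (f g h : Cube m → ℤ) → ℤ
convolution f g h = total (λ x → total (λ y → f x ℤ.* g y ℤ.* h (x ⊕ y)))

-- For f = g this diagonalises the quadratic form with matrix h (x ⊕ y). In the induction, adding
-- the two signs of the first bit doubles the products whose three first bits sum to 0 and cancels
-- the others; this is `butterfly`.
spectral-convolution : ∀ {m} (f g h : Cube m → ℤ) → spectral f g h ≡ (+ 2) ℤ.^ m ℤ.* convolution f g h
spectral-convolution {zero}  f g h = sym (ℤₚ.*-identityˡ _)
spectral-convolution {suc m} f g h = begin
  total (λ W → P₊ W) ℤ.+ total (λ W → P₋ W)
    ≡⟨ total-+ P₊ P₋ ⟨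
  total (λ W → P₊ W ℤ.+ P₋ W)
    ≡⟨ total-cong (λ W → butterfly (hat f₀ W) (hat f₁ W) (hat g₀ W) (hat g₁ W) (hat h₀ W) (hat h₁ W)) ⟩
  total (λ W → + 2 ℤ.* (s f₀ g₀ h₀ W ℤ.+ s f₀ g₁ h₁ W ℤ.+ (s f₁ g₀ h₁ W ℤ.+ s f₁ g₁ h₀ W)))
    ≡⟨ total-* (+ 2) (λ W → s f₀ g₀ h₀ W ℤ.+ s f₀ g₁ h₁ W ℤ.+ (s f₁ g₀ h₁ W ℤ.+ s f₁ g₁ h₀ W)) ⟩
  + 2 ℤ.* total (λ W → s f₀ g₀ h₀ W ℤ.+ s f₀ g₁ h₁ W ℤ.+ (s f₁ g₀ h₁ W ℤ.+ s f₁ g₁ h₀ W))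
    ≡⟨ cong (+ 2 ℤ.*_) (total-+₄ (s f₀ g₀ h₀) (s f₀ g₁ h₁) (s f₁ g₀ h₁) (s f₁ g₁ h₀)) ⟩
  + 2 ℤ.* (spectral f₀ g₀ h₀ ℤ.+ spectral f₀ g₁ h₁ ℤ.+ (spectral f₁ g₀ h₁ ℤ.+ spectral f₁ g₁ h₀))
    ≡⟨ cong (+ 2 ℤ.*_) (cong₂ ℤ._+_
         (cong₂ ℤ._+_ (spectral-convolution f₀ g₀ h₀) (spectral-convolution f₀ g₁ h₁))
         (cong₂ ℤ._+_ (spectral-convolution f₁ g₀ h₁) (spectral-convolution f₁ g₁ h₀))) ⟩
  + 2 ℤ.* (N ℤ.* convolution f₀ g₀ h₀ ℤ.+ N ℤ.* convolution f₀ g₁ h₁ ℤ.+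
           (N ℤ.* convolution f₁ g₀ h₁ ℤ.+ N ℤ.* convolution f₁ g₁ h₀))
    ≡⟨ factor N (convolution f₀ g₀ h₀) (convolution f₀ g₁ h₁) (convolution f₁ g₀ h₁) (convolution f₁ g₁ h₀) ⟩
  + 2 ℤ.* N ℤ.* (convolution f₀ g₀ h₀ ℤ.+ convolution f₀ g₁ h₁ ℤ.+
                 (convolution f₁ g₀ h₁ ℤ.+ convolution f₁ g₁ h₀))
    ≡⟨ cong (+ 2 ℤ.* N ℤ.*_) (cong₂ ℤ._+_
         (total-convolution f₀ g₀ h₀ f₀ g₁ h₁) (total-convolution f₁ g₀ h₁ f₁ g₁ h₀)) ⟨
  + 2 ℤ.* N ℤ.* convolution f g h ∎
  where
  open ≡-Reasoning
  N  = (+ 2) ℤ.^ m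
  f₀ = f ∘ (false ∷_)
  f₁ = f ∘ (true ∷_)
  g₀ = g ∘ (false ∷_)
  g₁ = g ∘ (true ∷_)
  h₀ = h ∘ (false ∷_)
  h₁ = h ∘ (true ∷_)
  s : (f g h : Cube m → ℤ) → Cube m → ℤ
  s f g h W = hat f W ℤ.* hat g W ℤ.* hat h W
  P₊ P₋ : Cube m → ℤ
  P₊ W = hat f (false ∷ W) ℤ.* hat g (false ∷ W) ℤ.* hat h (false ∷ W)
  P₋ W = hat f (true ∷ W) ℤ.* hat g (true ∷ W) ℤ.* hat h (true ∷ W)
  butterfly : ∀ a b c d e f →
    (a ℤ.+ 1ℤ ℤ.* b) ℤ.* (c ℤ.+ 1ℤ ℤ.* d) ℤ.* (e ℤ.+ 1ℤ ℤ.* f) ℤ.+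
    (a ℤ.+ ℤ.- 1ℤ ℤ.* b) ℤ.* (c ℤ.+ ℤ.- 1ℤ ℤ.* d) ℤ.* (e ℤ.+ ℤ.- 1ℤ ℤ.* f) ≡
    + 2 ℤ.* (a ℤ.* c ℤ.* e ℤ.+ a ℤ.* d ℤ.* f ℤ.+ (b ℤ.* c ℤ.* f ℤ.+ b ℤ.* d ℤ.* e))
  butterfly = solve-∀
  factor : ∀ n a b c d → + 2 ℤ.* (n ℤ.* a ℤ.+ n ℤ.* b ℤ.+ (n ℤ.* c ℤ.+ n ℤ.* d)) ≡
    + 2 ℤ.* n ℤ.* (a ℤ.+ b ℤ.+ (c ℤ.+ d))
  factor = solve-∀
  total-+₄ : (p q r t : Cube m → ℤ) → total (λ W → p W ℤ.+ q W ℤ.+ (r W ℤ.+ t W)) ≡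
             total p ℤ.+ total q ℤ.+ (total r ℤ.+ total t)
  total-+₄ p q r t = trans (total-+ (λ W → p W ℤ.+ q W) (λ W → r W ℤ.+ t W))
                           (cong₂ ℤ._+_ (total-+ p q) (total-+ r t))
  total-convolution : ∀ (f g h f′ g′ h′ : Cube m → ℤ) →
    total (λ x → total (λ y → f x ℤ.* g y ℤ.* h (x ⊕ y)) ℤ.+ total (λ y → f′ x ℤ.* g′ y ℤ.* h′ (x ⊕ y))) ≡
    convolution f g h ℤ.+ convolution f′ g′ h′
  total-convolution f g h f′ g′ h′ =
    total-+ (λ x → total (λ y → f x ℤ.* g y ℤ.* h (x ⊕ y))) (λ x → total (λ y → f′ x ℤ.* g′ y ℤ.* h′ (x ⊕ y)))

-- Even vectors, edges and linear forms

coweight : ∀ {m} → Cube m → ℕ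
coweight = count (𝔹ₚ._≟ false)

coweight+weight : ∀ {m} (x : Cube m) → coweight x + weight x ≡ m
coweight+weight []          = refl
coweight+weight (false ∷ x) = cong suc (coweight+weight x)
coweight+weight (true ∷ x)  = trans (ℕₚ.+-suc _ _) (cong suc (coweight+weight x))

hammingDistance-⊕ : ∀ {m} (x y : Cube m) → hammingDistance x y ≡ weight (x ⊕ y)
hammingDistance-⊕ []          []          = refl
hammingDistance-⊕ (false ∷ x) (false ∷ y) = hammingDistance-⊕ x y
hammingDistance-⊕ (false ∷ x) (true ∷ y)  = cong suc (hammingDistance-⊕ x y)
hammingDistance-⊕ (true ∷ x)  (false ∷ y) = cong suc (hammingDistance-⊕ x y)
hammingDistance-⊕ (true ∷ x)  (true ∷ y)  = hammingDistance-⊕ x y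

⊕-cancelˡ : ∀ {m} (x y : Cube m) → x ⊕ (x ⊕ y) ≡ y
⊕-cancelˡ []      []      = refl
⊕-cancelˡ (a ∷ x) (b ∷ y) = cong₂ _∷_
  (trans (sym (𝔹ₚ.xor-assoc a a b)) (cong (_xor b) (𝔹ₚ.xor-same a))) (⊕-cancelˡ x y)

weight≡0⇒≡ : ∀ {m} (x y : Cube m) → weight (x ⊕ y) ≡ 0 → x ≡ y
weight≡0⇒≡ []          []          _  = refl
weight≡0⇒≡ (false ∷ x) (false ∷ y) eq = cong (false ∷_) (weight≡0⇒≡ x y eq)
weight≡0⇒≡ (true ∷ x)  (true ∷ y)  eq = cong (true ∷_) (weight≡0⇒≡ x y eq)

weight-replicate-false : ∀ m → weight (replicate m false) ≡ 0
weight-replicate-false zero    = refl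
weight-replicate-false (suc m) = weight-replicate-false m

parity : ∀ {m} → Cube m → Bool
parity []      = false
parity (b ∷ x) = b xor parity x

parity-even : ∀ {m} (x : Cube m) → parity x ≡ false → 2 ∣ weight x
parity-odd  : ∀ {m} (x : Cube m) → parity x ≡ true → 2 ∣ suc (weight x)
parity-even []          _  = 2 ∣0
parity-even (false ∷ x) eq = parity-even x eq
parity-even (true ∷ x)  eq = parity-odd x (trans (sym (𝔹ₚ.not-involutive _)) (cong not eq))
parity-odd  (false ∷ x) eq = parity-odd x eq
parity-odd  (true ∷ x)  eq = ∣m∣n⇒∣m+n ∣-refl (parity-even x (trans (sym (𝔹ₚ.not-involutive _)) (cong not eq)))

even-parity : ∀ {m} (x : Cube m) → 2 ∣ weight x → parity x ≡ false
even-parity x 2∣x with parity x in eq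
... | false = refl
... | true  = contradiction
  (∣1⇒≡1 (∣m+n∣m⇒∣n (subst (2 ∣_) (ℕₚ.+-comm 1 (weight x)) (parity-odd x eq)) 2∣x)) λ ()

parity-⊕ : ∀ {m} (x y : Cube m) → parity (x ⊕ y) ≡ parity x xor parity y
parity-⊕ []          []          = refl
parity-⊕ (false ∷ x) (false ∷ y) = parity-⊕ x y
parity-⊕ (false ∷ x) (true ∷ y)  = trans (cong not (parity-⊕ x y)) (𝔹ₚ.not-distribʳ-xor (parity x) (parity y))
parity-⊕ (true ∷ x)  (false ∷ y) = trans (cong not (parity-⊕ x y)) (𝔹ₚ.not-distribˡ-xor (parity x) (parity y))
parity-⊕ (true ∷ x)  (true ∷ y)  = trans (parity-⊕ x y) (trans (sym (𝔹ₚ.not-involutive _))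
  (trans (cong not (𝔹ₚ.not-distribˡ-xor (parity x) (parity y))) (𝔹ₚ.not-distribʳ-xor (not (parity x)) (parity y))))

weight-⊕-even : ∀ {m} (x y : Cube m) → 2 ∣ weight x → 2 ∣ weight y → 2 ∣ weight (x ⊕ y)
weight-⊕-even x y 2∣x 2∣y = parity-even (x ⊕ y)
  (trans (parity-⊕ x y) (cong₂ _xor_ (even-parity x 2∣x) (even-parity y 2∣y)))

-- The even vectors on m + 1 coordinates are the graph of the parity function, so the whole group
-- `Cube m` can serve as vertex set.
extend : ∀ {m} → Cube m → Cube (suc m)
extend x = parity x ∷ x

extend-even : ∀ {m} (x : Cube m) → 2 ∣ weight (extend x)
extend-even x = parity-even (extend x) (𝔹ₚ.xor-same (parity x))

xor-false⇒≡ : ∀ a b → a xor b ≡ false → a ≡ b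
xor-false⇒≡ false b     eq = sym eq
xor-false⇒≡ true  true  eq = refl

even⇒extend : ∀ {m} b (x : Cube m) → 2 ∣ weight (b ∷ x) → b ∷ x ≡ extend x
even⇒extend b x 2∣bx = cong (_∷ x) (xor-false⇒≡ b (parity x) (even-parity (b ∷ x) 2∣bx))

extend-⊕ : ∀ {m} (x y : Cube m) → extend (x ⊕ y) ≡ extend x ⊕ extend y
extend-⊕ x y = cong (_∷ x ⊕ y) (parity-⊕ x y)

-- Characteristic function of weight k, written with `shift` so that its transform follows the
-- recursion of `K`.
indicator : ∀ {m} → ℕ → Cube m → ℤ
indicator k []          = K 0 0 k
indicator k (false ∷ x) = indicator k x
indicator k (true ∷ x)  = shift (λ j → indicator j x) k

indicator-*-cong : ∀ {m} k (x : Cube m) {c d : ℤ} → (weight x ≡ k → c ≡ d) →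
                   indicator k x ℤ.* c ≡ indicator k x ℤ.* d
indicator-*-cong zero    []          c≡d = cong (1ℤ ℤ.*_) (c≡d refl)
indicator-*-cong (suc k) []          c≡d = refl
indicator-*-cong k       (false ∷ x) c≡d = indicator-*-cong k x c≡d
indicator-*-cong zero    (true ∷ x)  c≡d = refl
indicator-*-cong (suc k) (true ∷ x)  c≡d = indicator-*-cong k x (c≡d ∘ cong suc)

hat-indicator : ∀ {m} k (W : Cube m) → hat (indicator k) W ≡ K (coweight W) (weight W) k
hat-indicator-shift : ∀ {m} k (W : Cube m) →
  hat (λ x → shift (λ j → indicator j x) k) W ≡ shift (K (coweight W) (weight W)) k
hat-indicator k []          = refl
hat-indicator k (false ∷ W) = cong₂ ℤ._+_ (hat-indicator k W)
  (trans (ℤₚ.*-identityˡ _) (hat-indicator-shift k W))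
hat-indicator k (true ∷ W)  = trans
  (cong₂ ℤ._+_ (hat-indicator k W) (trans (ℤₚ.-1*i≡-i _) (cong ℤ.-_ (hat-indicator-shift k W))))
  (sym (K-sucʳ (coweight W) (weight W) k))
hat-indicator-shift zero    W = hat-zero W
hat-indicator-shift (suc k) W = hat-indicator k W

-- For even k, this is the indicator of the z with weight (extend z) = k.
edge : ∀ {m} → ℕ → Cube m → ℤ
edge k z = indicator k (false ∷ z) ℤ.+ 1ℤ ℤ.* indicator k (true ∷ z)

edge-*-cong : ∀ {m} k (z : Cube m) {c d : ℤ} → 2 ∣ k → (weight (extend z) ≡ k → c ≡ d) →
              edge k z ℤ.* c ≡ edge k z ℤ.* d
edge-*-cong {m} k z {c} {d} 2∣k c≡d = begin
  edge k z ℤ.* c                    ≡⟨ distrib i j c ⟩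
  i ℤ.* c ℤ.+ j ℤ.* c               ≡⟨ cong₂ ℤ._+_ (indicator-*-cong k (false ∷ z) (via false))
                                                   (indicator-*-cong k (true ∷ z) (via true)) ⟩
  i ℤ.* d ℤ.+ j ℤ.* d               ≡⟨ distrib i j d ⟨
  edge k z ℤ.* d                    ∎
  where
  open ≡-Reasoning
  i = indicator k (false ∷ z)
  j = indicator k (true ∷ z)
  distrib : ∀ i j c → (i ℤ.+ 1ℤ ℤ.* j) ℤ.* c ≡ i ℤ.* c ℤ.+ j ℤ.* c
  distrib = solve-∀
  via : ∀ b → weight (b ∷ z) ≡ k → c ≡ d
  via b eq = c≡d (trans (cong weight (sym (even⇒extend b z (subst (2 ∣_) (sym eq) 2∣k)))) eq)

-- Summing over the first bit is evaluating the transform on m + 1 coordinates at `false ∷ W`; hence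
-- the additional coordinate in `suc (coweight W)`.
hat-edge : ∀ {m} k (W : Cube m) → hat (edge k) W ≡ K (suc (coweight W)) (weight W) k
hat-edge k W = trans (hat-+* 1ℤ (indicator k) (λ z → shift (λ j → indicator j z) k) W)
  (cong₂ ℤ._+_ (hat-indicator k W) (trans (ℤₚ.*-identityˡ _) (hat-indicator-shift k W)))

total-edge : ∀ m k → total {m} (edge k) ≡ K (suc m) 0 k
total-edge m k = begin
  total {m} (edge k)                   ≡⟨ total-hat {m} (edge k) ⟩
  hat (edge k) 𝟎                       ≡⟨ hat-edge k 𝟎 ⟩
  K (suc (coweight 𝟎)) (weight 𝟎) k    ≡⟨ cong₂ (λ a w → K (suc a) w k) coweight-𝟎 (weight-replicate-false m) ⟩
  K (suc m) 0 k                        ∎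
  where
  open ≡-Reasoning
  𝟎 = replicate m false
  coweight-𝟎 : coweight 𝟎 ≡ m
  coweight-𝟎 = trans (sym (ℕₚ.+-identityʳ _))
    (trans (cong (λ w → coweight 𝟎 + w) (sym (weight-replicate-false m))) (coweight+weight 𝟎))

total-indicator-zero : ∀ m → total {m} (indicator 0) ≡ 1ℤ
total-indicator-zero zero    = refl
total-indicator-zero (suc m) = cong₂ ℤ._+_ (total-indicator-zero m)
  (trans (total-hat {m} (λ _ → 0ℤ)) (hat-zero (replicate m false)))

dot : ∀ {n} → Vec ℤ n → Cube n → ℤ
dot []      []      = 0ℤ
dot (a ∷ c) (b ∷ x) = sign b ℤ.* a ℤ.+ dot c x

-- This and the following support lemmas are meant for an F that is itself a transform, so that
-- `hat F` is 2ᵐ times the original function. Splitting off the first bit of the frequency leaves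
-- smaller supports of the same kind for the two halves.
hat-supported-zero : ∀ {m} (F : Cube m → ℤ) → (∀ W → weight W ≢ 0 → F W ≡ 0ℤ) →
                     ∃[ p ] ∀ x → hat F x ≡ p
hat-supported-zero {zero}  F supp = F [] , λ { [] → refl }
hat-supported-zero {suc m} F supp with hat-supported-zero (F ∘ (false ∷_)) (supp ∘ (false ∷_))
... | p , eq = p , λ { (b ∷ x) → trans (cong₂ (λ u v → u ℤ.+ sign b ℤ.* v) (eq x)
        (hat-vanishes (λ W → supp (true ∷ W) λ ()) x))
        (trans (cong (λ u → p ℤ.+ u) (ℤₚ.*-zeroʳ (sign b))) (ℤₚ.+-identityʳ p)) }

sign-xor : ∀ a b → sign (a xor b) ≡ sign a ℤ.* sign b
sign-xor false false = refl
sign-xor false true  = refl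
sign-xor true  false = refl
sign-xor true  true  = refl

hat-supported-all : ∀ {m} (F : Cube m → ℤ) → (∀ W → coweight W ≢ 0 → F W ≡ 0ℤ) →
                    ∃[ q ] ∀ x → hat F x ≡ sign (parity x) ℤ.* q
hat-supported-all {zero}  F supp = F [] , λ { [] → sym (ℤₚ.*-identityˡ _) }
hat-supported-all {suc m} F supp with hat-supported-all (F ∘ (true ∷_)) (supp ∘ (true ∷_))
... | q , eq = q , λ { (b ∷ x) → trans (cong₂ (λ u v → u ℤ.+ sign b ℤ.* v)
        (hat-vanishes (λ W → supp (false ∷ W) λ ()) x) (eq x))
        (trans (ring (sign b) (sign (parity x)) q) (cong (ℤ._* q) (sym (sign-xor b (parity x))))) }
  where
  ring : ∀ b s q → 0ℤ ℤ.+ b ℤ.* (s ℤ.* q) ≡ b ℤ.* s ℤ.* q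
  ring = solve-∀

hat-supported-zero-all : ∀ {m} (F : Cube m → ℤ) → (∀ W → weight W ≢ 0 → coweight W ≢ 0 → F W ≡ 0ℤ) →
                         ∃₂ λ p q → ∀ x → hat F x ≡ p ℤ.+ sign (parity x) ℤ.* q
hat-supported-zero-all {zero}  F supp = 0ℤ , F [] , λ { [] → ring (F []) }
  where
  ring : ∀ q → q ≡ 0ℤ ℤ.+ 1ℤ ℤ.* q
  ring = solve-∀
hat-supported-zero-all {suc m} F supp
  with hat-supported-zero (F ∘ (false ∷_)) (λ W w≢0 → supp (false ∷ W) w≢0 λ ())
     | hat-supported-all (F ∘ (true ∷_)) (λ W a≢0 → supp (true ∷ W) (λ ()) a≢0)
... | p , eq-p | q , eq-q = p , q , λ { (b ∷ x) →
        trans (cong₂ (λ u v → u ℤ.+ sign b ℤ.* v) (eq-p x) (eq-q x))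
              (cong (λ u → p ℤ.+ u) (trans (sym (ℤₚ.*-assoc (sign b) (sign (parity x)) q))
                                    (cong (ℤ._* q) (sym (sign-xor b (parity x)))))) }

hat-supported-one : ∀ {m} (F : Cube m → ℤ) → (∀ W → weight W ≢ 1 → F W ≡ 0ℤ) →
                    ∃[ c ] ∀ x → hat F x ≡ dot c x
hat-supported-one {zero}  F supp = [] , λ { [] → supp [] λ () }
hat-supported-one {suc m} F supp
  with hat-supported-one (F ∘ (false ∷_)) (supp ∘ (false ∷_))
     | hat-supported-zero (F ∘ (true ∷_)) (λ W w≢0 → supp (true ∷ W) (w≢0 ∘ ℕₚ.suc-injective))
... | c , eq-c | p , eq-p = p ∷ c , λ { (b ∷ x) →
        trans (cong₂ (λ u v → u ℤ.+ sign b ℤ.* v) (eq-c x) (eq-p x)) (ℤₚ.+-comm (dot c x) (sign b ℤ.* p)) }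

-- The character of all coordinates of x is that of the parity coordinate of extend x.
hat-supported-linear : ∀ {m} (F : Cube m → ℤ) → (∀ W → weight W ≢ 1 → coweight W ≢ 0 → F W ≡ 0ℤ) →
                       ∃[ c ] ∀ x → hat F x ≡ dot c (extend x)
hat-supported-linear {zero}  F supp = F [] ∷ [] , λ { [] → ring (F []) }
  where
  ring : ∀ q → q ≡ 1ℤ ℤ.* q ℤ.+ 0ℤ
  ring = solve-∀
hat-supported-linear {suc m} F supp
  with hat-supported-one (F ∘ (false ∷_)) (λ W w≢1 → supp (false ∷ W) w≢1 λ ())
     | hat-supported-zero-all (F ∘ (true ∷_)) (λ W w≢0 a≢0 → supp (true ∷ W) (w≢0 ∘ ℕₚ.suc-injective) a≢0)
... | c , eq-c | p , q , eq-pq = q ∷ p ∷ c , λ { (b ∷ x) →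
        trans (cong₂ (λ u v → u ℤ.+ sign b ℤ.* v) (eq-c x) (eq-pq x))
        (trans (ring (dot c x) (sign b) (sign (parity x)) p q)
               (cong (λ s → s ℤ.* q ℤ.+ (sign b ℤ.* p ℤ.+ dot c x)) (sym (sign-xor b (parity x))))) }
  where
  ring : ∀ d b s p q → d ℤ.+ b ℤ.* (p ℤ.+ s ℤ.* q) ≡ b ℤ.* s ℤ.* q ℤ.+ (b ℤ.* p ℤ.+ d)
  ring = solve-∀

-- Characters are multiplicative, so a translation only changes signs of coefficients.
dot-⊕ : ∀ {n} (c : Vec ℤ n) (y : Cube n) → ∃[ c′ ] ∀ x → dot c (y ⊕ x) ≡ dot c′ x
dot-⊕ []      []      = [] , λ { [] → refl }
dot-⊕ (a ∷ c) (b ∷ y) with dot-⊕ c y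
... | c′ , eq = sign b ℤ.* a ∷ c′ , λ { (b′ ∷ x) → cong₂ ℤ._+_
        (trans (cong (ℤ._* a) (trans (cong sign (𝔹ₚ.xor-comm b b′)) (sign-xor b′ b)))
               (ℤₚ.*-assoc (sign b′) (sign b) a))
        (eq x) }

weight-surjective : ∀ {n k} → k ≤ n → ∃[ x ] weight {n} x ≡ k
weight-surjective {n} z≤n = replicate n false , weight-replicate-false n
weight-surjective (s≤s k≤n) with weight-surjective k≤n
... | x , eq = true ∷ x , cong suc eq

dot-tail : ∀ {n κ} s a (c : Vec ℤ n) x → s ℤ.* a ℤ.+ dot c x ≡ κ → dot c x ≡ κ ℤ.- s ℤ.* a
dot-tail s a c x eq = trans (ring (s ℤ.* a) (dot c x)) (cong (ℤ._- s ℤ.* a) eq)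
  where
  ring : ∀ u v → v ≡ u ℤ.+ v ℤ.- u
  ring = solve-∀

-- Moving a single 1 between the first two coordinates changes the value by twice the difference of
-- their coefficients. A weight strictly between 0 and n leaves room for this move.
dot-constant : ∀ {n} k (c : Vec ℤ n) κ → suc k < n → (∀ x → weight x ≡ suc k → dot c x ≡ κ) →
               ∃[ l ] c ≡ replicate n l
dot-constant-tail : ∀ {n} k a (c : Vec ℤ (suc n)) κ → k ≤ n →
                    (∀ x → weight x ≡ suc k → dot (a ∷ c) x ≡ κ) → ∃[ l ] c ≡ replicate (suc n) l

dot-constant k (a ∷ []) κ (s≤s ()) const
dot-constant k (a ∷ b ∷ c) κ (s≤s (s≤s k≤n)) const with dot-constant-tail k a (b ∷ c) κ k≤n const
... | l , refl = l , cong (_∷ b ∷ c) a≡b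
  where
  a≡b : a ≡ b
  a≡b with weight-surjective k≤n
  ... | u , refl = ℤₚ.*-cancelˡ-≡ (+ 2) a b (trans (ring₁ a b (dot c u))
        (trans (cong (λ z → b ℤ.+ a ℤ.- dot c u ℤ.+ z) same) (ring₂ a b (dot c u))))
    where
    same : 1ℤ ℤ.* a ℤ.+ (ℤ.- 1ℤ ℤ.* b ℤ.+ dot c u) ≡ ℤ.- 1ℤ ℤ.* a ℤ.+ (1ℤ ℤ.* b ℤ.+ dot c u)
    same = trans (const (false ∷ true ∷ u) refl) (sym (const (true ∷ false ∷ u) refl))
    ring₁ : ∀ a b d → + 2 ℤ.* a ≡ b ℤ.+ a ℤ.- d ℤ.+ (1ℤ ℤ.* a ℤ.+ (ℤ.- 1ℤ ℤ.* b ℤ.+ d))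
    ring₁ = solve-∀
    ring₂ : ∀ a b d → b ℤ.+ a ℤ.- d ℤ.+ (ℤ.- 1ℤ ℤ.* a ℤ.+ (1ℤ ℤ.* b ℤ.+ d)) ≡ + 2 ℤ.* b
    ring₂ = solve-∀

-- The first bit is fixed so that the remaining weight stays strictly between 0 and the remaining
-- length; where no choice does this, the tail has a single entry.
dot-constant-tail k a c κ k≤n const with ℕₚ.m≤n⇒m<n∨m≡n k≤n
dot-constant-tail k       a c        κ _ const | inj₁ k<n =
  dot-constant k c _ (s≤s k<n) (λ x w → dot-tail 1ℤ a c x (const (false ∷ x) w))
dot-constant-tail zero    a (b ∷ []) κ _ const | inj₂ refl = b , refl
dot-constant-tail (suc k) a c        κ _ const | inj₂ refl =
  dot-constant k c _ ℕₚ.≤-refl (λ x w → dot-tail (ℤ.- 1ℤ) a c x (const (true ∷ x) (cong suc w)))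

dot-replicate : ∀ {n} l (x : Cube n) → dot (replicate n l) x ≡ l ℤ.* (+ n ℤ.- + 2 ℤ.* + weight x)
dot-replicate l []          = sym (ℤₚ.*-zeroʳ l)
dot-replicate {suc n} l (false ∷ x) rewrite dot-replicate l x = ring l (+ n) (+ weight x)
  where
  ring : ∀ l n w → 1ℤ ℤ.* l ℤ.+ l ℤ.* (n ℤ.- + 2 ℤ.* w) ≡ l ℤ.* (1ℤ ℤ.+ n ℤ.- + 2 ℤ.* w)
  ring = solve-∀
dot-replicate {suc n} l (true ∷ x) rewrite dot-replicate l x = ring l (+ n) (+ weight x)
  where
  ring : ∀ l n w → ℤ.- 1ℤ ℤ.* l ℤ.+ l ℤ.* (n ℤ.- + 2 ℤ.* w) ≡ l ℤ.* (1ℤ ℤ.+ n ℤ.- + 2 ℤ.* (1ℤ ℤ.+ w))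
  ring = solve-∀

inner : ∀ {n} → Cube n → Cube n → ℤ
inner x y = sum (λ j → sign (lookup x j) ℤ.* sign (lookup y j))

inner-hammingDistance : ∀ {n} (x y : Cube n) → inner x y ≡ + n ℤ.- + 2 ℤ.* + hammingDistance x y
inner-hammingDistance []          []          = refl
inner-hammingDistance {suc n} (a ∷ x) (b ∷ y) = by-cases a b
  where
  h = hammingDistance x y
  IH = inner-hammingDistance x y
  same : ∀ n h → 1ℤ ℤ.+ (n ℤ.- + 2 ℤ.* h) ≡ 1ℤ ℤ.+ n ℤ.- + 2 ℤ.* h
  same = solve-∀
  different : ∀ n h → ℤ.- 1ℤ ℤ.+ (n ℤ.- + 2 ℤ.* h) ≡ 1ℤ ℤ.+ n ℤ.- + 2 ℤ.* (1ℤ ℤ.+ h)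
  different = solve-∀
  by-cases : ∀ a b → inner (a ∷ x) (b ∷ y) ≡ + suc n ℤ.- + 2 ℤ.* + hammingDistance (a ∷ x) (b ∷ y)
  by-cases false false = trans (cong (λ z → 1ℤ ℤ.+ z) IH) (same (+ n) (+ h))
  by-cases false true  = trans (cong (λ z → ℤ.- 1ℤ ℤ.+ z) IH) (different (+ n) (+ h))
  by-cases true  false = trans (cong (λ z → ℤ.- 1ℤ ℤ.+ z) IH) (different (+ n) (+ h))
  by-cases true  true  = trans (cong (λ z → 1ℤ ℤ.+ z) IH) (same (+ n) (+ h))

-- Distances under a homomorphism

hammingDistance-refl : ∀ {m} (x : Cube m) → hammingDistance x x ≡ 0
hammingDistance-refl []          = refl
hammingDistance-refl (false ∷ x) = hammingDistance-refl x
hammingDistance-refl (true ∷ x)  = hammingDistance-refl x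

K-zero : ∀ a w → K a w 0 ≡ 1ℤ
K-zero zero    zero    = refl
K-zero zero    (suc w) = trans (ℤₚ.+-identityʳ _) (K-zero zero w)
K-zero (suc a) w       = trans (ℤₚ.+-identityʳ _) (K-zero a w)

*-nonNeg : ∀ {i j} → 0ℤ ℤ.≤ i → 0ℤ ℤ.≤ j → 0ℤ ℤ.≤ i ℤ.* j
*-nonNeg {+ i} {+ j} _ _ = subst (0ℤ ℤ.≤_) (ℤₚ.pos-* i j) (+≤+ z≤n)

square-nonNeg : ∀ i → 0ℤ ℤ.≤ i ℤ.* i
square-nonNeg (+ n)      = *-nonNeg {+ n} {+ n} (+≤+ z≤n) (+≤+ z≤n)
square-nonNeg ℤ.-[1+ n ] = +≤+ z≤n

square-zero : ∀ i {j} → 0ℤ ℤ.< j → i ℤ.* i ℤ.* j ≡ 0ℤ → i ≡ 0ℤ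
square-zero i 0<j eq with ℤₚ.i*j≡0⇒i≡0∨j≡0 (i ℤ.* i) eq
... | inj₂ j≡0 = contradiction (sym j≡0) (ℤₚ.<⇒≢ 0<j)
... | inj₁ i²≡0 with ℤₚ.i*j≡0⇒i≡0∨j≡0 i i²≡0
...   | inj₁ i≡0 = i≡0
...   | inj₂ i≡0 = i≡0

2^m-nonZero : ∀ m → ℤ.NonZero ((+ 2) ℤ.^ m)
2^m-nonZero zero    = _
2^m-nonZero (suc m) = ℤₚ.i*j≢0 (+ 2) ((+ 2) ℤ.^ m) where instance _ = 2^m-nonZero m

sum-vanishes : ∀ {n} {t : Fin n → ℤ} → (∀ j → t j ≡ 0ℤ) → sum t ≡ 0ℤ
sum-vanishes {zero}  t≗0 = refl
sum-vanishes {suc n} t≗0 = cong₂ ℤ._+_ (t≗0 zero) (sum-vanishes (t≗0 ∘ suc))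

-- Eliminates the unknown l between distances 0 and w. The term `+ 2 ℤ.* 0ℤ` shows `diagonal` as the
-- case of weight 0 of the same formula.
inner-ratio : ∀ N .{{_ : ℤ.NonZero N}} n n′ i l h w → N ℤ.* n′ ≡ l ℤ.* (n ℤ.- + 2 ℤ.* 0ℤ) →
              N ℤ.* i ≡ l ℤ.* (n ℤ.- + 2 ℤ.* w) → i ≡ n′ ℤ.- + 2 ℤ.* h → n ℤ.* h ≡ n′ ℤ.* w
inner-ratio N n n′ i l h w diagonal eq inner≡ = ℤₚ.*-cancelˡ-≡ (+ 2) (n ℤ.* h) (n′ ℤ.* w) (begin
  + 2 ℤ.* (n ℤ.* h)                          ≡⟨ ring₁ n n′ h ⟩
  n ℤ.* n′ ℤ.- n ℤ.* (n′ ℤ.- + 2 ℤ.* h)      ≡⟨ cong (λ u → n ℤ.* n′ ℤ.- u) scaled ⟩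
  n ℤ.* n′ ℤ.- n′ ℤ.* (n ℤ.- + 2 ℤ.* w)      ≡⟨ ring₂ n n′ w ⟩
  + 2 ℤ.* (n′ ℤ.* w)                         ∎)
  where
  open ≡-Reasoning
  ring₁ : ∀ n n′ h → + 2 ℤ.* (n ℤ.* h) ≡ n ℤ.* n′ ℤ.- n ℤ.* (n′ ℤ.- + 2 ℤ.* h)
  ring₁ = solve-∀
  ring₂ : ∀ n n′ w → n ℤ.* n′ ℤ.- n′ ℤ.* (n ℤ.- + 2 ℤ.* w) ≡ + 2 ℤ.* (n′ ℤ.* w)
  ring₂ = solve-∀
  ring₃ : ∀ N n i → N ℤ.* (n ℤ.* i) ≡ n ℤ.* (N ℤ.* i)
  ring₃ = solve-∀
  ring₄ : ∀ n l d → n ℤ.* (l ℤ.* d) ≡ l ℤ.* (n ℤ.- + 2 ℤ.* 0ℤ) ℤ.* d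
  ring₄ = solve-∀
  scaled : n ℤ.* (n′ ℤ.- + 2 ℤ.* h) ≡ n′ ℤ.* (n ℤ.- + 2 ℤ.* w)
  scaled = ℤₚ.*-cancelˡ-≡ N (n ℤ.* (n′ ℤ.- + 2 ℤ.* h)) (n′ ℤ.* (n ℤ.- + 2 ℤ.* w)) (begin
    N ℤ.* (n ℤ.* (n′ ℤ.- + 2 ℤ.* h))
      ≡⟨ cong (λ i → N ℤ.* (n ℤ.* i)) inner≡ ⟨
    N ℤ.* (n ℤ.* i)
      ≡⟨ ring₃ N n i ⟩
    n ℤ.* (N ℤ.* i)
      ≡⟨ cong (n ℤ.*_) eq ⟩
    n ℤ.* (l ℤ.* (n ℤ.- + 2 ℤ.* w))
      ≡⟨ ring₄ n l (n ℤ.- + 2 ℤ.* w) ⟩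
    l ℤ.* (n ℤ.- + 2 ℤ.* 0ℤ) ℤ.* (n ℤ.- + 2 ℤ.* w)
      ≡⟨ cong (ℤ._* (n ℤ.- + 2 ℤ.* w)) diagonal ⟨
    N ℤ.* n′ ℤ.* (n ℤ.- + 2 ℤ.* w)
      ≡⟨ ℤₚ.*-assoc N n′ (n ℤ.- + 2 ℤ.* w) ⟩
    N ℤ.* (n′ ℤ.* (n ℤ.- + 2 ℤ.* w)) ∎)

module _ {m n′ : ℕ} (k₀ k′ s : ℕ)
         (2∣k : 2 ∣ suc k₀) (k≤m : suc k₀ ≤ m) (2k≡n+2+s : suc k₀ + suc k₀ ≡ suc m + (2 + s))
         (ratio : suc m * k′ ≡ n′ * suc k₀) (F : Cube m → Cube n′)
         (F-edge : ∀ x y → weight (extend (x ⊕ y)) ≡ suc k₀ → hammingDistance (F x) (F y) ≡ k′)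
  where

  private
    k n : ℕ
    k = suc k₀
    n = suc m

    g : Fin n′ → Cube m → ℤ
    g j x = sign (lookup (F x) j)

    L κ N : ℤ
    L = D m k
    κ = + n′ ℤ.- + 2 ℤ.* + k′
    N = (+ 2) ℤ.^ m

    -- Convolution kernel of A + L I, where A is the adjacency matrix and -L its least eigenvalue.
    kernel : Cube m → ℤ
    kernel z = edge k z ℤ.+ L ℤ.* indicator 0 z

    hat-kernel : ∀ W → hat kernel W ≡ K (suc (coweight W)) (weight W) k ℤ.+ L
    hat-kernel W = trans (hat-+* L (edge k) (indicator 0) W) (cong₂ ℤ._+_ (hat-edge k W)
      (trans (cong (L ℤ.*_) (trans (hat-indicator 0 W) (K-zero (coweight W) (weight W)))) (ℤₚ.*-identityʳ L)))

    hat-kernel-nonNeg : ∀ W → 0ℤ ℤ.≤ hat kernel W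
    hat-kernel-nonNeg W rewrite hat-kernel W = subst
      (λ m → k + k ≡ suc m + (2 + s) → 0ℤ ℤ.≤ K (suc (coweight W)) (weight W) k ℤ.+ D m k)
      (coweight+weight W) (K+D-nonNeg (coweight W) (weight W) k (suc s)) 2k≡n+2+s

    hat-kernel-pos : ∀ W → coweight W ≢ 0 → weight W ≢ 1 → 0ℤ ℤ.< hat kernel W
    hat-kernel-pos W a≢0 w≢1 rewrite hat-kernel W = subst
      (λ m → k + k ≡ suc m + (2 + s) → k ≤ m → 0ℤ ℤ.< K (suc (coweight W)) (weight W) k ℤ.+ D m k)
      (coweight+weight W)
      (λ e l → K+D-pos (coweight W) (weight W) k s e l a≢0 w≢1) 2k≡n+2+s k≤m

    inner-edge : ∀ x y → weight (extend (x ⊕ y)) ≡ k → inner (F x) (F y) ≡ κ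
    inner-edge x y e = trans (inner-hammingDistance (F x) (F y))
      (cong (λ d → + n′ ℤ.- + 2 ℤ.* + d) (F-edge x y e))

    inner-self : ∀ x → inner (F x) (F x) ≡ + n′
    inner-self x = trans (inner-hammingDistance (F x) (F x))
      (trans (cong (λ d → + n′ ℤ.- + 2 ℤ.* + d) (hammingDistance-refl (F x))) (ℤₚ.+-identityʳ (+ n′)))

    averaged : Cube m → ℤ
    averaged z = κ ℤ.* edge k z ℤ.+ L ℤ.* + n′ ℤ.* indicator 0 z

    -- The kernel sees only equal or adjacent pairs, where the inner product of the images is n′ or
    -- κ; the unknown map `F` drops out.
    inner-kernel : ∀ x y → inner (F x) (F y) ℤ.* kernel (x ⊕ y) ≡ averaged (x ⊕ y)
    inner-kernel x y = begin
      inner (F x) (F y) ℤ.* (e ℤ.+ L ℤ.* i)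
        ≡⟨ ring₁ (inner (F x) (F y)) e L i ⟩
      e ℤ.* inner (F x) (F y) ℤ.+ L ℤ.* (i ℤ.* inner (F x) (F y))
        ≡⟨ cong₂ (λ u v → u ℤ.+ L ℤ.* v)
             (edge-*-cong k (x ⊕ y) 2∣k (inner-edge x y))
             (indicator-*-cong 0 (x ⊕ y) λ w≡0 →
               subst (λ y → inner (F x) (F y) ≡ + n′) (weight≡0⇒≡ x y w≡0) (inner-self x)) ⟩
      e ℤ.* κ ℤ.+ L ℤ.* (i ℤ.* + n′)
        ≡⟨ ring₂ e κ L i (+ n′) ⟩
      averaged (x ⊕ y) ∎
      where
      open ≡-Reasoning
      e = edge k (x ⊕ y)
      i = indicator 0 (x ⊕ y)
      ring₁ : ∀ c e l i → c ℤ.* (e ℤ.+ l ℤ.* i) ≡ e ℤ.* c ℤ.+ l ℤ.* (i ℤ.* c)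
      ring₁ = solve-∀
      ring₂ : ∀ e c l i n → e ℤ.* c ℤ.+ l ℤ.* (i ℤ.* n) ≡ c ℤ.* e ℤ.+ l ℤ.* n ℤ.* i
      ring₂ = solve-∀

    ratio-ℤ : + n ℤ.* + k′ ≡ + n′ ℤ.* + k
    ratio-ℤ = trans (sym (ℤₚ.pos-* n k′)) (trans (cong +_ ratio) (ℤₚ.pos-* n′ k))

    -- Equality in the eigenvalue bound: n/k = n′/k′ says that κ/n′ is -L divided by the degree
    -- `K n 0 k`.
    total-averaged : total averaged ≡ 0ℤ
    total-averaged = ℤₚ.*-cancelˡ-≡ (+ n) (total averaged) 0ℤ (begin
      + n ℤ.* total averaged
        ≡⟨ cong (+ n ℤ.*_) (trans (total-+ {m} (λ z → κ ℤ.* edge k z) (λ z → L ℤ.* + n′ ℤ.* indicator 0 z))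
             (cong₂ ℤ._+_
               (trans (total-* {m} κ (edge k)) (cong (κ ℤ.*_) (total-edge m k)))
               (trans (total-* {m} (L ℤ.* + n′) (indicator 0)) (cong (L ℤ.* + n′ ℤ.*_) (total-indicator-zero m))))) ⟩
      + n ℤ.* (κ ℤ.* B ℤ.+ L ℤ.* + n′ ℤ.* 1ℤ)
        ≡⟨ ring₁ (+ n) (+ n′) (+ k′) B L ⟩
      + n ℤ.* + n′ ℤ.* B ℤ.- + 2 ℤ.* (+ n ℤ.* + k′) ℤ.* B ℤ.+ + n ℤ.* L ℤ.* + n′
        ≡⟨ cong₂ (λ u v → + n ℤ.* + n′ ℤ.* B ℤ.- + 2 ℤ.* u ℤ.* B ℤ.+ v ℤ.* + n′) ratio-ℤ (D-K₀ m k) ⟩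
      + n ℤ.* + n′ ℤ.* B ℤ.- + 2 ℤ.* (+ n′ ℤ.* + k) ℤ.* B ℤ.+ (+ k ℤ.+ + k ℤ.- + n) ℤ.* B ℤ.* + n′
        ≡⟨ ring₂ (+ n) (+ n′) (+ k) B ⟩
      0ℤ
        ≡⟨ ℤₚ.*-zeroʳ (+ n) ⟨
      + n ℤ.* 0ℤ ∎)
      where
      open ≡-Reasoning
      B = K n 0 k
      ring₁ : ∀ n n′ k′ b l → n ℤ.* ((n′ ℤ.- + 2 ℤ.* k′) ℤ.* b ℤ.+ l ℤ.* n′ ℤ.* 1ℤ) ≡
              n ℤ.* n′ ℤ.* b ℤ.- + 2 ℤ.* (n ℤ.* k′) ℤ.* b ℤ.+ n ℤ.* l ℤ.* n′
      ring₁ = solve-∀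
      ring₂ : ∀ n n′ k b → n ℤ.* n′ ℤ.* b ℤ.- + 2 ℤ.* (n′ ℤ.* k) ℤ.* b ℤ.+ (k ℤ.+ k ℤ.- n) ℤ.* b ℤ.* n′ ≡ 0ℤ
      ring₂ = solve-∀

    -- On edges only the sum over all coordinates j is known. Nonnegativity of the terms will pass
    -- the vanishing on to each j and each frequency.
    sum-spectral : sum (λ j → spectral (g j) (g j) kernel) ≡ 0ℤ
    sum-spectral = begin
      sum (λ j → spectral (g j) (g j) kernel)
        ≡⟨ sum-cong-≗ (λ j → spectral-convolution (g j) (g j) kernel) ⟩
      sum (λ j → N ℤ.* convolution (g j) (g j) kernel)
        ≡⟨ *-distribˡ-sum N (λ j → convolution (g j) (g j) kernel) ⟨
      N ℤ.* sum (λ j → convolution (g j) (g j) kernel)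
        ≡⟨ cong (N ℤ.*_) (sum-total (λ j x → total (λ y → g j x ℤ.* g j y ℤ.* kernel (x ⊕ y)))) ⟩
      N ℤ.* total (λ x → sum (λ j → total (λ y → g j x ℤ.* g j y ℤ.* kernel (x ⊕ y))))
        ≡⟨ cong (N ℤ.*_) (total-cong λ x → trans
             (sum-total (λ j y → g j x ℤ.* g j y ℤ.* kernel (x ⊕ y)))
             (total-cong λ y → trans
               (sym (*-distribʳ-sum (kernel (x ⊕ y)) (λ j → g j x ℤ.* g j y)))
               (inner-kernel x y))) ⟩
      N ℤ.* total (λ x → total (λ y → averaged (x ⊕ y)))
        ≡⟨ cong (N ℤ.*_) (total-cong λ x → trans (total-shift averaged x) total-averaged) ⟩
      N ℤ.* total {m} (λ x → 0ℤ)
        ≡⟨ cong (N ℤ.*_) (trans (total-hat {m} (λ _ → 0ℤ)) (hat-zero (replicate m false))) ⟩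
      N ℤ.* 0ℤ
        ≡⟨ ℤₚ.*-zeroʳ N ⟩
      0ℤ ∎
      where open ≡-Reasoning

    spectral-term : Fin n′ → Cube m → ℤ
    spectral-term j W = hat (g j) W ℤ.* hat (g j) W ℤ.* hat kernel W

    spectral-term-nonNeg : ∀ j W → 0ℤ ℤ.≤ spectral-term j W
    spectral-term-nonNeg j W = *-nonNeg {hat (g j) W ℤ.* hat (g j) W} {hat kernel W}
      (square-nonNeg (hat (g j) W)) (hat-kernel-nonNeg W)

    spectral-term-vanishes : ∀ j W → spectral-term j W ≡ 0ℤ
    spectral-term-vanishes j W = total-zero⁻¹ {f = spectral-term j} (spectral-term-nonNeg j)
      (sum-zero⁻¹ {t = λ j → total (spectral-term j)}
        (λ j → total-nonNeg {f = spectral-term j} (spectral-term-nonNeg j)) sum-spectral j) W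

    hat-g-vanishes : ∀ j W → weight W ≢ 1 → coweight W ≢ 0 → hat (g j) W ≡ 0ℤ
    hat-g-vanishes j W w≢1 a≢0 =
      square-zero (hat (g j) W) (hat-kernel-pos W a≢0 w≢1) (spectral-term-vanishes j W)

    hat-inner-vanishes : ∀ x W → weight W ≢ 1 → coweight W ≢ 0 → hat (λ y → inner (F x) (F y)) W ≡ 0ℤ
    hat-inner-vanishes x W w≢1 a≢0 = trans (hat-sum (λ j → g j x) g W) (sum-vanishes λ j →
      trans (cong (g j x ℤ.*_) (hat-g-vanishes j W w≢1 a≢0)) (ℤₚ.*-zeroʳ (g j x)))

    -- Recentring at x makes the weight of `extend z` the distance from x, so adjacency to x becomes
    -- a condition of constant weight, as `dot-constant` requires.
    2^m*inner-linear : ∀ x → ∃[ c ] ∀ z → N ℤ.* inner (F x) (F (x ⊕ z)) ≡ dot c (extend z)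
    2^m*inner-linear x =
      let c , eq   = hat-supported-linear (hat (λ y → inner (F x) (F y))) (hat-inner-vanishes x)
          c′ , eq′ = dot-⊕ c (extend x)
      in c′ , λ z → trans (sym (hat-hat (λ y → inner (F x) (F y)) (x ⊕ z)))
                (trans (eq (x ⊕ z)) (trans (cong (dot c) (extend-⊕ x z)) (eq′ (extend z))))

    2^m*inner-constant : ∀ x c → (∀ z → N ℤ.* inner (F x) (F (x ⊕ z)) ≡ dot c (extend z)) →
                         ∀ v → weight v ≡ k → dot c v ≡ N ℤ.* κ
    2^m*inner-constant x c eq (b ∷ z) w≡k = trans (cong (dot c) v≡) (trans (sym (eq z))
      (cong (N ℤ.*_) (inner-edge x (x ⊕ z)
        (trans (cong (λ u → weight (extend u)) (⊕-cancelˡ x z)) (trans (cong weight (sym v≡)) w≡k)))))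
      where
      v≡ : b ∷ z ≡ extend z
      v≡ = even⇒extend b z (subst (2 ∣_) (sym w≡k) 2∣k)

    2^m*inner : ∀ x → ∃[ l ] ∀ z → N ℤ.* inner (F x) (F (x ⊕ z)) ≡ l ℤ.* (+ n ℤ.- + 2 ℤ.* + weight (extend z))
    2^m*inner x =
      let c , eq = 2^m*inner-linear x
          l , c≡ = dot-constant k₀ c (N ℤ.* κ) (s≤s k≤m) (2^m*inner-constant x c eq)
      in l , λ z → trans (eq z) (trans (cong (λ c → dot c (extend z)) c≡) (dot-replicate l (extend z)))

  hammingDistance-scales : ∀ x z → n * hammingDistance (F x) (F (x ⊕ z)) ≡ n′ * weight (extend z)
  hammingDistance-scales x z = ℤₚ.+-injective (trans (ℤₚ.pos-* n h) (trans
    (inner-ratio N {{2^m-nonZero m}} (+ n) (+ n′) (inner (F x) (F (x ⊕ z))) l (+ h) (+ w)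
      diagonal (eq z) (inner-hammingDistance (F x) (F (x ⊕ z))))
    (sym (ℤₚ.pos-* n′ w))))
    where
    l  = proj₁ (2^m*inner x)
    eq = proj₂ (2^m*inner x)
    h = hammingDistance (F x) (F (x ⊕ z))
    w = weight (extend z)
    𝟎 = replicate m false
    weight-𝟎 : weight (extend 𝟎) ≡ 0
    weight-𝟎 rewrite even-parity 𝟎 (subst (2 ∣_) (sym (weight-replicate-false m)) (2 ∣0)) =
      weight-replicate-false m
    x⊕𝟎 : x ⊕ 𝟎 ≡ x
    x⊕𝟎 = zipWith-identityʳ 𝔹ₚ.xor-identityʳ x
    -- The coefficient l was obtained for each x separately; z = 0 pins it down through l n = 2ᵐ n′.
    diagonal : N ℤ.* + n′ ≡ l ℤ.* (+ n ℤ.- + 2 ℤ.* 0ℤ)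
    diagonal = trans (cong (N ℤ.*_) (sym (trans (cong (λ y → inner (F x) (F y)) x⊕𝟎) (inner-self x))))
      (trans (eq 𝟎) (cong (λ w → l ℤ.* (+ n ℤ.- + 2 ℤ.* + w)) weight-𝟎))

-- Homomorphisms and multiples

weight-++ : ∀ {m n} (x : Cube m) (y : Cube n) → weight (x ++ y) ≡ weight x + weight y
weight-++ []          y = refl
weight-++ (false ∷ x) y = weight-++ x y
weight-++ (true ∷ x)  y = cong suc (weight-++ x y)

copies : ∀ {m} q → Cube m → Cube (q * m)
copies q x = concat (replicate q x)

weight-copies : ∀ {m} q (x : Cube m) → weight (copies q x) ≡ q * weight x
weight-copies zero    x = refl
weight-copies (suc q) x = trans (weight-++ x (copies q x)) (cong (λ w → weight x + w) (weight-copies q x))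

copies-⊕ : ∀ {m} q (x y : Cube m) → copies q x ⊕ copies q y ≡ copies q (x ⊕ y)
copies-⊕ zero    x y = refl
copies-⊕ (suc q) x y = trans (zipWith-++ _ x (copies q x) y (copies q y))
  (cong (λ z → (x ⊕ y) ++ z) (copies-⊕ q x y))

hammingDistance-copies : ∀ {m} q (x y : Cube m) →
                         hammingDistance (copies q x) (copies q y) ≡ q * hammingDistance x y
hammingDistance-copies q x y = begin
  hammingDistance (copies q x) (copies q y) ≡⟨ hammingDistance-⊕ (copies q x) (copies q y) ⟩
  weight (copies q x ⊕ copies q y)          ≡⟨ cong weight (copies-⊕ q x y) ⟩
  weight (copies q (x ⊕ y))                 ≡⟨ weight-copies q (x ⊕ y) ⟩
  q * weight (x ⊕ y)                        ≡⟨ cong (q *_) (hammingDistance-⊕ x y) ⟨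
  q * hammingDistance x y                   ∎
  where open ≡-Reasoning

copies-hom : ∀ n k q → Hom (H n k) (H (q * n) (q * k))
copies-hom n k q = record
  { map      = λ { (x , [ 2∣x ]) → copies q x , [ subst (2 ∣_) (sym (weight-copies q x)) (∣n⇒∣m*n q 2∣x) ] }
  ; preserve = λ {x} {y} eq → trans (hammingDistance-copies q (value x) (value y)) (cong (q *_) eq)
  }

*-rotate : ∀ a b c → a * b * c ≡ b * (a * c)
*-rotate = ℕRing.solve-∀

multiples⇒hom : ∀ {n k n′ k′} → 0 < n → n * k′ ≡ n′ * k → n ∣ n′ → Hom (H n k) (H n′ k′)
multiples⇒hom {n} {k} {k′ = k′} 0<n ratio (divides-refl q) =
  subst (λ j → Hom (H n k) (H (q * n) j)) (sym k′≡) (copies-hom n k q)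
  where
  k′≡ : k′ ≡ q * k
  k′≡ = ℕₚ.*-cancelˡ-≡ k′ (q * k) n {{ℕ.>-nonZero 0<n}} (trans ratio (*-rotate q n k))

value-injective : ∀ {A P} {u v : Refinement {0ℓ} {0ℓ} A P} → value u ≡ value v → u ≡ v
value-injective {u = _ , _} {_ , _} refl = refl

vertex-even : ∀ {m} (u : Refinement (Cube m) (λ x → 2 ∣ weight x)) → 2 ∣ weight (value u)
vertex-even (x , [ 2∣x ]) = recompute (2 ∣? weight x) 2∣x

extended : ∀ m k → Cube m → Vertex (H (suc m) k)
extended m k x = extend x , [ extend-even x ]

vertex-extended : ∀ {m} k (u : Vertex (H (suc m) k)) → u ≡ extended m k (tail (value u))
vertex-extended k u@(b ∷ x , _) = value-injective (even⇒extend b x (vertex-even u))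

module _ {m n′ : ℕ} (k k′ s : ℕ)
         (2∣k : 2 ∣ k) (0<k : 0 < k) (k≤m : k ≤ m) (2k≡n+2+s : k + k ≡ suc m + (2 + s))
         (ratio : suc m * k′ ≡ n′ * k) (k′≢0 : k′ ≢ 0)
         (f : Hom (H (suc m) k) (H n′ k′))
  where

  open Hom f

  private
    n : ℕ
    n = suc m

    F : Cube m → Cube n′
    F x = value (map (extended m k x))

    F-edge : ∀ x y → weight (extend (x ⊕ y)) ≡ k → hammingDistance (F x) (F y) ≡ k′
    F-edge x y eq = preserve (trans (hammingDistance-⊕ (extend x) (extend y))
      (trans (cong weight (sym (extend-⊕ x y))) eq))

    F-scales : ∀ x z → n * hammingDistance (F x) (F (x ⊕ z)) ≡ n′ * weight (extend z)
    -- `hammingDistance-scales` is stated for a successor, so all hypotheses that mention k are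
    -- transported together along `suc (pred k) ≡ k`.
    F-scales = subst Scales (ℕₚ.suc-pred k {{ℕ.>-nonZero 0<k}}) scales 2∣k k≤m 2k≡n+2+s ratio F-edge
      where
      Scales : ℕ → Set
      Scales k = 2 ∣ k → k ≤ m → k + k ≡ n + (2 + s) → n * k′ ≡ n′ * k →
        (∀ x y → weight (extend (x ⊕ y)) ≡ k → hammingDistance (F x) (F y) ≡ k′) →
        ∀ x z → n * hammingDistance (F x) (F (x ⊕ z)) ≡ n′ * weight (extend z)
      scales : Scales (suc (ℕ.pred k))
      scales a b c d e = hammingDistance-scales (ℕ.pred k) k′ s a b c d F e

    n′≢0 : n′ ≢ 0
    n′≢0 refl = k′≢0 (ℕₚ.*-cancelˡ-≡ k′ 0 n (trans ratio (sym (ℕₚ.*-zeroʳ n))))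

    instance
      n′-nonZero : NonZero n′
      n′-nonZero = ≢-nonZero n′≢0

  hom-scales : ∀ u v → n * hammingDistance (value (map u)) (value (map v)) ≡
                       n′ * hammingDistance (value u) (value v)
  hom-scales u v rewrite vertex-extended k u | vertex-extended k v = begin
    n * hammingDistance (F x) (F y)              ≡⟨ cong (λ z → n * hammingDistance (F x) (F z)) (⊕-cancelˡ x y) ⟨
    n * hammingDistance (F x) (F (x ⊕ (x ⊕ y)))  ≡⟨ F-scales x (x ⊕ y) ⟩
    n′ * weight (extend (x ⊕ y))                 ≡⟨ cong (λ z → n′ * weight z) (extend-⊕ x y) ⟩
    n′ * weight (extend x ⊕ extend y)            ≡⟨ cong (n′ *_) (hammingDistance-⊕ (extend x) (extend y)) ⟨
    n′ * hammingDistance (extend x) (extend y)   ∎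
    where
    open ≡-Reasoning
    x = tail (value u)
    y = tail (value v)

  hom⇒multiples : n ∣ n′ × k ∣ k′
  hom⇒multiples = divides q n′≡ , divides q (ℕₚ.*-cancelˡ-≡ k′ (q * k) n
    (trans ratio (trans (cong (_* k) n′≡) (*-rotate q n k))))
    where
    open ≡-Reasoning
    𝟎 z : Cube m
    𝟎 = replicate m false
    v : ∃[ v ] weight {n} v ≡ 2
    v = weight-surjective (s≤s (ℕₚ.≤-trans 0<k k≤m))
    z = tail (proj₁ v)
    weight-tail : ∀ (v : Cube n) → weight v ≡ 2 → weight (extend (tail v)) ≡ 2
    weight-tail (b ∷ z) w≡2 =
      trans (cong weight (sym (even⇒extend b z (subst (2 ∣_) (sym w≡2) (divides-refl 1))))) w≡2
    weight-z : weight (extend z) ≡ 2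
    weight-z = weight-tail (proj₁ v) (proj₂ v)
    d = hammingDistance (F 𝟎) (F (𝟎 ⊕ z))
    -- The scaling alone yields n d = 2n′, hence only n ∣ 2n′. The missing factor 2 comes from the
    -- target having even vectors only.
    2∣d : 2 ∣ d
    2∣d = subst (2 ∣_) (sym (hammingDistance-⊕ (F 𝟎) (F (𝟎 ⊕ z))))
      (weight-⊕-even (F 𝟎) (F (𝟎 ⊕ z))
        (vertex-even (map (extended m k 𝟎))) (vertex-even (map (extended m k (𝟎 ⊕ z)))))
    q = quotient 2∣d
    n′≡ : n′ ≡ q * n
    n′≡ = ℕₚ.*-cancelʳ-≡ n′ (q * n) 2 (begin
      n′ * 2                  ≡⟨ cong (n′ *_) weight-z ⟨
      n′ * weight (extend z)  ≡⟨ F-scales 𝟎 z ⟨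
      n * d                   ≡⟨ cong (n *_) (_∣_.equality 2∣d) ⟩
      n * (q * 2)             ≡⟨ *-rotate q n 2 ⟨
      q * n * 2               ∎)

  hom-embeds : IsIsomorphismToInducedSubgraph (H n k) (H n′ k′) map
  hom-embeds = Image , image-map , record
    { bijective = (λ eq → map-injective (cong value eq)) , surjective
    ; adjacency = λ u v → mk⇔ preserve (reflect u v)
    }
    where
    -- Preimages range over `Cube m`, so that membership can be decided by exhaustive search over
    -- subsets; `surjective` needs this to recover a preimage from an irrelevant membership proof.
    Image : Vertex (H n′ k′) → Set
    Image v = ∃[ x ] F x ≡ value v

    image? : ∀ v → Dec (Image v)
    image? v = anySubset? (λ x → ≡-dec 𝔹ₚ._≟_ (F x) (value v))

    reflect : ∀ u v → hammingDistance (value (map u)) (value (map v)) ≡ k′ →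
              hammingDistance (value u) (value v) ≡ k
    reflect u v eq = ℕₚ.*-cancelˡ-≡ _ k n′ (trans (sym (hom-scales u v)) (trans (cong (n *_) eq) ratio))

    map-injective : ∀ {u v} → map u ≡ map v → u ≡ v
    map-injective {u} {v} eq = value-injective (weight≡0⇒≡ (value u) (value v)
      (trans (sym (hammingDistance-⊕ (value u) (value v))) (ℕₚ.*-cancelˡ-≡ _ 0 n′ (begin
        n′ * hammingDistance (value u) (value v)              ≡⟨ hom-scales u v ⟨
        n * hammingDistance (value (map u)) (value (map v))   ≡⟨ cong (λ z → n * hammingDistance (value (map u)) (value z)) eq ⟨
        n * hammingDistance (value (map u)) (value (map u))   ≡⟨ cong (n *_) (hammingDistance-refl (value (map u))) ⟩
        n * 0                                                 ≡⟨ ℕₚ.*-zeroʳ n ⟩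
        0                                                     ≡⟨ ℕₚ.*-zeroʳ n′ ⟨
        n′ * 0                                                ∎))))
      where open ≡-Reasoning

    image-map : ∀ u → Image (map u)
    image-map u = tail (value u) , cong (value ∘ map) (sym (vertex-extended k u))

    surjective : ∀ w → ∃[ u ] ∀ {v} → v ≡ u →
                 _≡_ {A = Vertex (induced (H n′ k′) Image)} (map v , [ image-map v ]) w
    surjective (v , [ v∈ ]) = extended m k (proj₁ preimage) ,
      λ { refl → value-injective (value-injective (proj₂ preimage)) }
      where
      preimage : Image v
      preimage = recompute (image? v) v∈

/-cross : ∀ n k n′ k′ .{{_ : NonZero k}} .{{_ : NonZero k′}} →
          (+ n) / k ≡ (+ n′) / k′ → n * k′ ≡ n′ * k
/-cross n zero    n′ k′       eq = contradiction refl (≢-nonZero⁻¹ 0)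
/-cross n (suc k) n′ zero     eq = contradiction refl (≢-nonZero⁻¹ 0)
/-cross n (suc k) n′ (suc k′) eq
  with ℚᵘ.*≡* e ← ℚₚ.fromℚᵘ-injective {ℚᵘ.mkℚᵘ (+ n) k} {ℚᵘ.mkℚᵘ (+ n′) k′} eq =
  ℤₚ.+-injective (trans (ℤₚ.pos-* n (suc k′)) (trans e (sym (ℤₚ.pos-* n′ (suc k)))))

theorem5p5 : (n k n' k' : ℕ) .{{_ : NonZero k}} .{{_ : NonZero k'}} →
    k < n → n < 2 * k ∸ 1 → (+ n) / k ≡ (+ n') / k' → 2 ∣ k → 2 ∣ k' →
    (Hom (H n k) (H n' k') ⇔ (n ∣ n' × k ∣ k')) ×
    ((f : Hom (H n k) (H n' k')) → IsIsomorphismToInducedSubgraph (H n k) (H n' k') (Hom.map f))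
theorem5p5 (suc m) k n' k' k<n@(s≤s k≤m) n<2k∸1 n/k≡n'/k' 2∣k _ =
  mk⇔ (hom⇒multiples k k' s 2∣k 0<k k≤m 2k≡n+2+s ratio k'≢0)
      (λ { (n∣n' , _) → multiples⇒hom (s≤s z≤n) ratio n∣n' }) ,
  hom-embeds k k' s 2∣k 0<k k≤m 2k≡n+2+s ratio k'≢0
  where
  n = suc m
  ratio : n * k' ≡ n' * k
  ratio = /-cross n k n' k' n/k≡n'/k'
  k'≢0 : k' ≢ 0
  k'≢0 = ≢-nonZero⁻¹ k'
  0<k : 0 < k
  0<k = ℕ.>-nonZero⁻¹ k
  n+2≤2k : n + 2 ≤ k + k
  n+2≤2k = begin
    n + 2               ≡⟨ ℕₚ.+-suc n 1 ⟩
    suc n + 1           ≤⟨ ℕₚ.+-monoˡ-≤ 1 n<2k∸1 ⟩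
    2 * k ∸ 1 + 1       ≡⟨ ℕₚ.m∸n+n≡m (ℕₚ.≤-trans 0<k (ℕₚ.m≤m+n k (k + 0))) ⟩
    2 * k               ≡⟨ cong (λ j → k + j) (ℕₚ.+-identityʳ k) ⟩
    k + k               ∎
    where open ℕₚ.≤-Reasoning
  s = k + k ∸ (n + 2)
  2k≡n+2+s : k + k ≡ n + (2 + s)
  2k≡n+2+s = trans (sym (ℕₚ.m+[n∸m]≡n n+2≤2k)) (ℕₚ.+-assoc n 2 s)
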